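{- The $3$-EDA problem (Exact Diameter-$3$ Augmentation) is solvable in polynomial time. That is, there is a polynomial-time algorithm which, given a connected graph $G$, decides whether there is a set $F\subseteq E(G)$ such that $G-F$ is a connected graph of diameter exactly $3$.
   Context: All graphs are finite, simple and undirected. For $F\subseteq E(G)$, $G-F$ is the graph with vertex set $V(G)$ and edge set $E(G)\setminus F$. The diameter of a connected graph $G$ is $\mathrm{diam}(G)=\max_{u,v\in V(G)}\mathrm{dist}_G(u,v)$, where $\mathrm{dist}_G(u,v)$ is the minimum number of edges of a $u,v$-path. For a fixed positive integer $d$, the Exact Diameter-$d$ Augmentation problem ($d$-EDA) is the following decision problem. Input: a connected graph $G$. Question: is there a set $F\subseteq E(G)$ such that $G-F$ is a connected graph of diameter $d$? -}

module Defs where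

open import Data.Bool using (Bool; true; false; _∧_; not)
open import Data.Fin using (Fin)
open import Data.List using (List; []; _∷_; _++_; length; concat; map; replicate; tabulate)
open import Data.List.Relation.Unary.Unique.Propositional using (Unique)
open import Data.Maybe using (Maybe; just; nothing)
open import Data.Nat using (ℕ; suc; _+_; _*_; _^_; _≤_; NonZero)
open import Data.Nat.GeneralisedArithmetic using (iterate)
open import Data.Product using (Σ; ∃-syntax; _×_; _,_; proj₁; proj₂)
open import Data.Vec as Vec using (Vec)
open import Function.Bundles using (_⇔_; _↔_)
open import Relation.Binary.PropositionalEquality using (_≡_; cong; cong₂)

record Graph (n : ℕ) : Set where
  field
    adj     : Fin n → Fin n → Bool
    adj-sym : ∀ u v → adj u v ≡ adj v u
    no-loop : ∀ u → adj u u ≡ false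

open Graph public

-- F ⊆ E(G); an undirected edge uv is recorded in both orientations.
record EdgeSubset {n : ℕ} (G : Graph n) : Set where
  field
    mem     : Fin n → Fin n → Bool
    mem-sym : ∀ u v → mem u v ≡ mem v u
    subset  : ∀ u v → mem u v ≡ true → adj G u v ≡ true

open EdgeSubset public

infixl 6 _─_

_─_ : ∀ {n} (G : Graph n) → EdgeSubset G → Graph n
(G ─ F) .adj u v     = adj G u v ∧ not (mem F u v)
(G ─ F) .adj-sym u v = cong₂ (λ a b → a ∧ not b) (adj-sym G u v) (mem-sym F u v)
(G ─ F) .no-loop u   = cong (_∧ not (mem F u u)) (no-loop G u)

data Walk {n : ℕ} (G : Graph n) : Fin n → Fin n → Set where
  stop : ∀ {u} → Walk G u u
  step : ∀ {u v w} → adj G u v ≡ true → Walk G v w → Walk G u w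

module _ {n : ℕ} {G : Graph n} where

  edgeCount : ∀ {u v} → Walk G u v → ℕ
  edgeCount stop       = 0
  edgeCount (step _ p) = suc (edgeCount p)

  vertices : ∀ {u v} → Walk G u v → List (Fin n)
  vertices {u} stop       = u ∷ []
  vertices {u} (step _ p) = u ∷ vertices p

module _ {n : ℕ} (G : Graph n) where

  Path : Fin n → Fin n → Set
  Path u v = Σ (Walk G u v) λ p → Unique (vertices p)

  -- The null graph is not connected (its diameter would be an empty maximum).
  Connected : Set
  Connected = NonZero n × (∀ u v → Path u v)

  Dist : Fin n → Fin n → ℕ → Set
  Dist u v k = (Σ (Path u v) λ p → edgeCount (proj₁ p) ≡ k)
             × (∀ (p : Path u v) → k ≤ edgeCount (proj₁ p))

  Diameter : ℕ → Set
  Diameter d = (∀ u v → ∃[ k ] Dist u v k × k ≤ d)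
             × (∃[ u ] ∃[ v ] Dist u v d)

data Symbol (a : ℕ) : Set where
  blank : Symbol a
  bit   : Bool → Symbol a
  aux   : Fin a → Symbol a

data Move : Set where
  left stay right : Move

-- A two-way infinite tape, blank outside the recorded part.  Both lists are
-- ordered outwards from the head.
record Tape (a : ℕ) : Set where
  constructor tape
  field
    before : List (Symbol a)
    head   : Symbol a
    after  : List (Symbol a)

open Tape public

module _ {a : ℕ} where

  emptyTape : Tape a
  emptyTape = tape [] blank []

  -- The head starts on the first bit of the input.
  inputTape : List Bool → Tape a
  inputTape []       = emptyTape
  inputTape (b ∷ bs) = tape [] (bit b) (map bit bs)

  move : Move → Tape a → Tape a
  move stay  t                   = t
  move left  (tape []       x r) = tape [] blank (x ∷ r)
  move left  (tape (y ∷ l)  x r) = tape l y (x ∷ r)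
  move right (tape l x [])       = tape (x ∷ l) blank []
  move right (tape l x (y ∷ r))  = tape (x ∷ l) y r

  writeMove : Symbol a × Move → Tape a → Tape a
  writeMove (s , m) t = move m (record t { head = s })

-- The first of the 1 + extraTapes tapes holds the input.
-- verdict q is just true / just false when q is accepting / rejecting, and
-- nothing when q is not a halting state.
record TuringMachine : Set₁ where
  field
    extraTapes : ℕ
    auxSymbols : ℕ
    State      : Set
    finite     : ∃[ m ] (State ↔ Fin m)
    start      : State
    verdict    : State → Maybe Bool
    δ          : State → Vec (Symbol auxSymbols) (suc extraTapes) →
                 State × Vec (Symbol auxSymbols × Move) (suc extraTapes)

module _ (M : TuringMachine) where
  open TuringMachine M

  record Config : Set where
    constructor config
    field
      state : State
      tapes : Vec (Tape auxSymbols) (suc extraTapes)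

  open Config

  initial : List Bool → Config
  initial w = config start (inputTape w Vec.∷ Vec.replicate extraTapes emptyTape)

  -- Halting configurations are fixed.
  next : Config → Config
  next c with verdict (state c)
  ... | just _  = c
  ... | nothing =
    let q , actions = δ (state c) (Vec.map head (tapes c))
    in  config q (Vec.zipWith writeMove actions (tapes c))

  -- On input w, M halts after at most T steps with answer b.
  AnswersWithin : ℕ → List Bool → Bool → Set
  AnswersWithin T w b =
    ∃[ t ] t ≤ T × verdict (state (iterate next (initial w) t)) ≡ just b

record DecisionProblem : Set₁ where
  field
    Instance : Set
    encode   : Instance → List Bool
    Yes      : Instance → Set

PolynomialTimeSolvable : DecisionProblem → Set₁
PolynomialTimeSolvable P =
  Σ TuringMachine λ M → ∃[ c ] ∃[ k ] ((x : Instance) →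
    ∃[ b ] AnswersWithin M (c * length (encode x) ^ k + c) (encode x) b
         × (b ≡ true ⇔ Yes x))
  where open DecisionProblem P

record ConnectedGraph : Set where
  field
    order     : ℕ
    graph     : Graph order
    connected : Connected graph

-- 1ⁿ 0 followed by the adjacency matrix, row by row.
encodeGraph : ∀ {n} → Graph n → List Bool
encodeGraph {n} G =
  replicate n true ++ false ∷ concat (tabulate λ u → tabulate λ v → adj G u v)

-- The Exact Diameter-d Augmentation problem.  Only connected graphs are
-- instances, so nothing is required of a machine on other words.
EDA : ℕ → DecisionProblem
EDA d = record
  { Instance = ConnectedGraph
  ; encode   = λ I → encodeGraph (graph I)
  ; Yes      = λ I → Σ (EdgeSubset (graph I)) λ F →
                 Connected (graph I ─ F) × Diameter (graph I ─ F) d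
  }
  where open ConnectedGraph

{-# OPTIONS --safe #-}

-- Idea.  Let G be connected.  A spanning connected subgraph of diameter 3
-- exists iff G has at least four vertices, all distances in G are at most 3,
-- and some two distinct vertices do not have exactly one walk of length 1 or 2
-- between them.  If all pairs have exactly one, then G has no triangle and no
-- four-cycle, so no edge has a replacement path of length at most 3, and G
-- itself has diameter at most 2.  Conversely, a pair without such a walk has
-- distance 3 already; otherwise G has diameter at most 2 and contains a
-- triangle or a four-cycle.  Removing an edge of a triangle keeps all distances
-- at most 3.  So edges in triangles are removed one by one until some distance
-- is 3, or no triangle is left, and then removing an edge of a four-cycle works,
-- or the last removal, of uv from a triangle uvw, has destroyed all triangles
-- and four-cycles, and then removing uw instead of uv works.
--
-- The criterion is tested by a Turing machine with five tapes: the matrix A, a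
-- 0/1-vector s, a vector t of saturating counters, the unit vector of the
-- current vertex u, and one cell of flags.  The step t := t + A s, performed
-- three times for every u, yields the numbers of walks that are needed.

module Submission where

open import Defs
open import Data.Bool using (Bool; true; false; if_then_else_; _∧_; _∨_; not)
open import Data.Bool.Properties using (∨-assoc; ∨-identityʳ; T-≡; ¬-not; not-¬) renaming (_≟_ to _≟ᵇ_)
open import Data.Fin as Fin using (Fin; zero; suc; toℕ; fromℕ<)
open import Data.Fin.Patterns
open import Data.Fin.Properties
  using (+↔⊎; 1↔⊤; 2↔Bool; _≟_; <⇒≢; any?; pigeonhole; suc-injective; toℕ-injective; toℕ<n; toℕ-fromℕ<)
open import Data.List as List
  using (List; []; _∷_; _++_; _ʳ++_; length; tabulate; concat; replicate; allFin; cartesianProduct)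
open import Data.List.Membership.DecPropositional using (_∈?_)
open import Data.List.Membership.Propositional using (_∈_)
open import Data.List.Membership.Propositional.Properties
  using (∈-lookup; ∈-allFin; ∈-cartesianProduct⁺)
open import Data.List.Properties
  using (ʳ++-ʳ++; ʳ++-defn; ++-ʳ++; ++-assoc; concat-map; length-++; length-map; length-replicate;
         length-reverse; length-tabulate; map-++; map-replicate; map-tabulate; tabulate-cong)
open import Data.List.Relation.Unary.All as All using (All; []; _∷_)
open import Data.List.Relation.Unary.All.Properties using (tabulate⁺; concat⁺; ¬Any⇒All¬)
open import Data.List.Relation.Unary.AllPairs using ([]; _∷_)
open import Data.List.Relation.Unary.Any using (here; there)
open import Data.List.Relation.Unary.Unique.Propositional using (Unique)
open import Data.Maybe using (Maybe; just; nothing; maybe)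
open import Data.Nat
  using (ℕ; zero; suc; _+_; _*_; _^_; _≤_; _<_; z≤n; s≤s; _<ᵇ_; _≡ᵇ_; NonZero)
open import Data.Nat.GeneralisedArithmetic using (iterate)
open import Data.Nat.Properties hiding (_≟_; suc-injective; <⇒≢)
open import Data.Nat.Tactic.RingSolver using (solve-∀)
open import Data.Product using (Σ; ∃-syntax; ∃₂; _×_; _,_; proj₁; proj₂; map₂)
open import Data.Sum using (_⊎_; inj₁; inj₂; swap; [_,_]′)
open import Data.Sum.Function.Propositional using (_⊎-↔_)
open import Data.Unit using (⊤; tt)
open import Data.Vec as Vec using (Vec; []; _∷_; _[_]≔_)
open import Function.Base using (_∘_; const)
open import Function.Bundles using (_⇔_; _↔_; mk⇔; Equivalence)
open import Function.Properties.Inverse using (↔-sym; ↔-trans)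
open import Relation.Binary.PropositionalEquality
open import Relation.Nullary using (¬_; Dec; yes; no; does; contradiction)
open import Relation.Nullary.Decidable
  using (_×-dec_; _⊎-dec_; ¬?; map′; decidable-stable; dec-true; dec-false)

-- Structured programs and the Turing machines that run them

module _ {a k : ℕ} where

  Heads : Set
  Heads = Vec (Symbol a) (suc k)

  Actions : Set
  Actions = Vec (Symbol a × Move) (suc k)

  Tapes : Set
  Tapes = Vec (Tape a) (suc k)

  infixr 5 _⨾_

  data Program : Set where
    perform : (Heads → Actions) → Program
    _⨾_     : Program → Program → Program
    while   : (Heads → Bool) → Program → Program

  act : (Heads → Actions) → Tapes → Tapes
  act f ts = Vec.zipWith writeMove (f (Vec.map head ts)) ts

  -- The number is an upper bound on the machine steps, since `weaken` may raise it. Each test of a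
  -- loop costs a step of its own; sequencing costs nothing.
  data Executes : Program → Tapes → ℕ → Tapes → Set where
    performed : ∀ {f ts ts'} → act f ts ≡ ts' → Executes (perform f) ts 1 ts'
    _then_    : ∀ {p q ts ts' ts'' m n} → Executes p ts m ts' →
                Executes q ts' n ts'' → Executes (p ⨾ q) ts (m + n) ts''
    exit      : ∀ {c p ts} → c (Vec.map head ts) ≡ false →
                Executes (while c p) ts 1 ts
    again     : ∀ {c p ts ts' ts'' m n} → c (Vec.map head ts) ≡ true →
                Executes p ts m ts' → Executes (while c p) ts' n ts'' →
                Executes (while c p) ts (suc (m + n)) ts''
    weaken    : ∀ {p ts ts' m n} → m ≤ n → Executes p ts m ts' → Executes p ts n ts'

  from-≡ : ∀ {p ts ts' ts'' n} → ts ≡ ts' → Executes p ts' n ts'' → Executes p ts n ts''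
  from-≡ refl d = d

  to-≡ : ∀ {p ts ts' ts'' n} → ts' ≡ ts'' → Executes p ts n ts' → Executes p ts n ts''
  to-≡ refl d = d

  -- The control states: one for each action and one for the test of each loop.
  Point : Program → Set
  Point (perform _) = ⊤
  Point (p ⨾ q)     = Point p ⊎ Point q
  Point (while _ p) = ⊤ ⊎ Point p

  finite-Point : ∀ p → ∃[ m ] (Point p ↔ Fin m)
  finite-Point (perform _) = 1 , ↔-sym 1↔⊤
  finite-Point (p ⨾ q) with finite-Point p | finite-Point q
  ... | m , i | n , j = m + n , ↔-trans (i ⊎-↔ j) (↔-sym +↔⊎)
  finite-Point (while _ p) with finite-Point p
  ... | m , i = 1 + m , ↔-trans (↔-sym 1↔⊤ ⊎-↔ i) (↔-sym +↔⊎)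

  entry : ∀ p → Point p
  entry (perform _) = tt
  entry (p ⨾ q)     = inj₁ (entry p)
  entry (while _ p) = inj₁ tt

  idle : Heads → Actions
  idle = Vec.map (_, stay)

  -- The next point is nothing when the program ends.
  follow : ∀ p → Point p → Heads → Maybe (Point p) × Actions
  follow (perform f) _ h = nothing , f h
  follow (p ⨾ q) (inj₁ s) h with follow p s h
  ... | s' , α = just (maybe inj₁ (inj₂ (entry q)) s') , α
  follow (p ⨾ q) (inj₂ s) h with follow q s h
  ... | s' , α = maybe (just ∘ inj₂) nothing s' , α
  follow (while c p) (inj₁ _) h =
    (if c h then just (inj₂ (entry p)) else nothing) , idle h
  follow (while c p) (inj₂ s) h with follow p s h
  ... | s' , α = just (maybe inj₂ (inj₁ tt) s') , α

  act-idle : ∀ {n} (ts : Vec (Tape a) n) →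
             Vec.zipWith writeMove (Vec.map (_, stay) (Vec.map head ts)) ts ≡ ts
  act-idle []       = refl
  act-idle (t ∷ ts) = cong (t ∷_) (act-idle ts)

  module _ {Q : Set} (run : Q × Tapes → Q × Tapes) where

    -- run behaves like p on the points of p (embedded in Q by e), and
    -- continues at x when p ends.
    Simulates : ∀ p → (Point p → Q) → Q → Set
    Simulates p e x = ∀ s ts →
      run (e s , ts) ≡ (maybe e x (proj₁ (follow p s (Vec.map head ts))) ,
                        Vec.zipWith writeMove (proj₂ (follow p s (Vec.map head ts))) ts)

    Reaches : ℕ → Q × Tapes → Q × Tapes → Set
    Reaches n c c' = ∃[ t ] t ≤ n × iterate run c t ≡ c'

    Reaches-step : ∀ {n c c' c''} → run c ≡ c' → Reaches n c' c'' → Reaches (suc n) c c''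
    Reaches-step refl (t , t≤n , eq) = suc t , s≤s t≤n , eq

    Reaches-trans : ∀ {m n c c' c''} → Reaches m c c' → Reaches n c' c'' →
                    Reaches (m + n) c c''
    Reaches-trans {m} {n} (zero , _ , refl) (t , t≤n , eq) =
      t , ≤-trans t≤n (m≤n+m n m) , eq
    Reaches-trans (suc s , s≤s s≤m , eq) r =
      Reaches-step refl (Reaches-trans (s , s≤m , eq) r)

    -- Induction on the execution, for arbitrary `e` and `x`: the first half of a sequence exits
    -- into the entry of the second, and the body of a loop exits into its test.
    simulate : ∀ {p ts n ts'} (e : Point p → Q) (x : Q) → Simulates p e x →
               Executes p ts n ts' → Reaches n (e (entry p) , ts) (x , ts')
    simulate e x sim (performed refl) = Reaches-step (sim tt _) (0 , z≤n , refl)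
    simulate {p ⨾ q} e x sim (d then d') = Reaches-trans
      (simulate (e ∘ inj₁) (e (inj₂ (entry q))) first d)
      (simulate (e ∘ inj₂) x second d')
      where
      first : Simulates p (e ∘ inj₁) (e (inj₂ (entry q)))
      first s ts with follow p s (Vec.map head ts) | sim (inj₁ s) ts
      ... | just _  , _ | eq = eq
      ... | nothing , _ | eq = eq
      second : Simulates q (e ∘ inj₂) x
      second s ts with follow q s (Vec.map head ts) | sim (inj₂ s) ts
      ... | just _  , _ | eq = eq
      ... | nothing , _ | eq = eq
    simulate {while c p} {ts} e x sim (exit ended) = Reaches-step moved (0 , z≤n , refl)
      where
      moved : run (e (inj₁ tt) , ts) ≡ (x , ts)
      moved = trans (sim (inj₁ tt) ts) (cong₂ _,_
        (cong (λ b → maybe e x (if b then just (inj₂ (entry p)) else nothing)) ended)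
        (act-idle ts))
    simulate {while c p} {ts} e x sim (again {ts' = ts'} go d d') =
      Reaches-step moved (Reaches-trans
        (simulate (e ∘ inj₂) (e (inj₁ tt)) inner d)
        (simulate e x sim d'))
      where
      moved : run (e (inj₁ tt) , ts) ≡ (e (inj₂ (entry p)) , ts)
      moved = trans (sim (inj₁ tt) ts) (cong₂ _,_
        (cong (λ b → maybe e x (if b then just (inj₂ (entry p)) else nothing)) go)
        (act-idle ts))
      inner : Simulates p (e ∘ inj₂) (e (inj₁ tt))
      inner s ts with follow p s (Vec.map head ts) | sim (inj₂ s) ts
      ... | just _  , _ | eq = eq
      ... | nothing , _ | eq = eq
    simulate e x sim (weaken m≤n d) with simulate e x sim d
    ... | t , t≤m , eq = t , ≤-trans t≤m m≤n , eq

-- Besides the program points there are two halting states and one state that reads off the answer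
-- once the program has ended, at the cost of one more step.
compile : ∀ {a k} → Program {a} {k} → (Heads {a} {k} → Bool) → TuringMachine
compile {a} {k} p accept = record
  { extraTapes = k
  ; auxSymbols = a
  ; State      = Point p ⊎ (⊤ ⊎ Bool)
  ; finite     = proj₁ (finite-Point p) + 3 ,
                 ↔-trans (proj₂ (finite-Point p) ⊎-↔
                          ↔-trans (↔-sym 1↔⊤ ⊎-↔ ↔-sym 2↔Bool) (↔-sym +↔⊎))
                         (↔-sym +↔⊎)
  ; start      = inj₁ (entry p)
  ; verdict    = λ { (inj₂ (inj₂ b)) → just b ; _ → nothing }
  ; δ          = λ
      { (inj₁ s) h        → maybe inj₁ (inj₂ (inj₁ tt)) (proj₁ (follow p s h)) ,
                            proj₂ (follow p s h)
      ; (inj₂ (inj₁ _)) h → inj₂ (inj₂ (accept h)) , idle h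
      ; (inj₂ (inj₂ b)) h → inj₂ (inj₂ b) , idle h
      }
  }

compile-answers : ∀ {a k} (p : Program {a} {k}) accept {w n ts} →
  Executes p (inputTape w ∷ Vec.replicate k emptyTape) n ts →
  AnswersWithin (compile p accept) (n + 1) w (accept (Vec.map head ts))
compile-answers {a} {k} p accept {w} {n} {ts} d =
  t , t≤n+1 , cong verdict (trans (sym (state-iterate t _)) (cong proj₁ eq))
  where
  M = compile p accept
  open TuringMachine M
  run : State × Tapes {a} {k} → State × Tapes {a} {k}
  run (q , ts) = Config.state c , Config.tapes c
    where c = next M (config q ts)
  state-iterate : ∀ t c → proj₁ (iterate run c t) ≡
                  Config.state (iterate (next M) (config (proj₁ c) (proj₂ c)) t)
  state-iterate zero    c = refl
  state-iterate (suc t) c = state-iterate t (run c)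
  -- No program point is a halting state, so `next` unfolds to `follow` by computation.
  simulates : Simulates run p inj₁ (inj₂ (inj₁ tt))
  simulates s ts = refl
  reach : Reaches run (n + 1) (inj₁ (entry p) , inputTape w ∷ Vec.replicate k emptyTape)
                              (inj₂ (inj₂ (accept (Vec.map head ts))) , ts)
  reach = Reaches-trans run (simulate run inj₁ (inj₂ (inj₁ tt)) simulates d)
    (Reaches-step run (cong (inj₂ (inj₂ (accept (Vec.map head ts))) ,_) (act-idle {k = k} ts))
                      (0 , z≤n , refl))
  t = proj₁ reach
  t≤n+1 = proj₁ (proj₂ reach)
  eq = proj₂ (proj₂ reach)

-- Tapes holding words

module _ {a : ℕ} where

  full : Symbol a → Bool
  full blank = false
  full _     = true

  Full : List (Symbol a) → Set
  Full = All (λ x → full x ≡ true)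

  -- Reading position between l (nearest symbol first) and r.
  toTape : List (Symbol a) → List (Symbol a) → Tape a
  toTape l []      = tape l blank []
  toTape l (x ∷ r) = tape l x r

  move-right : ∀ l x r → move right (tape l x r) ≡ toTape (x ∷ l) r
  move-right l x []      = refl
  move-right l x (_ ∷ _) = refl

  -- Moving off a word and back leaves explicit blanks on both of its sides,
  -- so words are kept between explicit blanks from the outset.
  atStart atEnd : List (Symbol a) → List (Symbol a) → Tape a
  atStart l xs = toTape (blank ∷ l) (xs ++ blank ∷ [])
  atEnd   l xs = tape (xs ʳ++ blank ∷ l) blank []

  module _ {k : ℕ} where

    moveAt : Fin (suc k) → Move → Heads {a} {k} → Actions {a} {k}
    moveAt i d h = Vec.updateAt (idle h) i (λ α → proj₁ α , d)

    act-moveAt : ∀ i d (ts : Tapes {a} {k}) {t} →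
                 act (moveAt i d) (ts [ i ]≔ t) ≡ ts [ i ]≔ move d t
    act-moveAt = go
      where
      go : ∀ {n} (i : Fin n) d (ts : Vec (Tape a) n) {t} →
           Vec.zipWith writeMove
             (Vec.updateAt (Vec.map (_, stay) (Vec.map head (ts [ i ]≔ t))) i (λ α → proj₁ α , d))
             (ts [ i ]≔ t) ≡ ts [ i ]≔ move d t
      go zero    d (t ∷ ts) = cong (_ ∷_) (act-idle {k = k} ts)
      go (suc i) d (t ∷ ts) = cong (t ∷_) (go i d ts)

    head-update : ∀ {n} (i : Fin n) (ts : Vec (Tape a) n) {t} →
                  Vec.lookup (Vec.map head (ts [ i ]≔ t)) i ≡ head t
    head-update zero    (_ ∷ _)  = refl
    head-update (suc i) (_ ∷ ts) = head-update i ts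

    update-lookup : ∀ {n} (i : Fin n) (ts : Vec (Tape a) n) {t} →
                    Vec.lookup ts i ≡ t → ts ≡ ts [ i ]≔ t
    update-lookup zero    (_ ∷ _)  refl = refl
    update-lookup (suc i) (t ∷ ts) eq   = cong (t ∷_) (update-lookup i ts eq)

    fullAt : Fin (suc k) → Heads {a} {k} → Bool
    fullAt i h = full (Vec.lookup h i)

    -- The head starts on the blank behind the word, hence the first move. The loop stops on the
    -- blank in front of the word.
    rewind : Fin (suc k) → Program {a} {k}
    rewind i = perform (moveAt i left) ⨾ while (fullAt i) (perform (moveAt i left))
               ⨾ perform (moveAt i right)

    Full-ʳ++ : ∀ {xs ys} → Full xs → Full ys → Full (xs ʳ++ ys)
    Full-ʳ++ []       fys = fys
    Full-ʳ++ (x ∷ fs) fys = Full-ʳ++ fs (x ∷ fys)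

    -- Giving the start as an unevaluated move treats empty and nonempty `zs` alike.
    leftwards : ∀ i (ts : Tapes {a} {k}) {zs l y ys} → Full zs →
      Executes (while (fullAt i) (perform (moveAt i left)))
        (ts [ i ]≔ move left (tape (zs ++ blank ∷ l) y ys)) (2 * length zs + 1)
        (ts [ i ]≔ tape l blank (zs ʳ++ y ∷ ys))
    leftwards i ts []       = exit (cong full (head-update i ts))
    leftwards i ts {z ∷ zs} (fz ∷ fs) =
      weaken (≤-reflexive (arith (length zs)))
        (again (trans (cong full (head-update i ts)) fz)
               (performed (act-moveAt i left ts)) (leftwards i ts fs))
      where
      arith : ∀ n → suc (1 + (2 * n + 1)) ≡ 2 * suc n + 1
      arith = solve-∀

    rewind-executes : ∀ i (ts : Tapes {a} {k}) {xs l} → Full xs →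
      Vec.lookup ts i ≡ atEnd l xs →
      Executes (rewind i) ts (2 * length xs + 3) (ts [ i ]≔ atStart l xs)
    rewind-executes i ts {xs} {l} fs eq =
      weaken (≤-reflexive (arith (length xs)))
        (performed (trans (cong (act (moveAt i left)) ts≡) (act-moveAt i left ts))
        then (weaken (≤-reflexive (cong (λ n → 2 * n + 1) (length-reverse xs)))
                (leftwards i ts {zs = List.reverse xs} (Full-ʳ++ fs []))
        then performed (trans (act-moveAt i right ts) (cong (ts [ i ]≔_)
               (trans (move-right l blank _)
                      (cong (toTape (blank ∷ l)) (ʳ++-ʳ++ xs {[]})))))))
      where
      ts≡ : ts ≡ ts [ i ]≔ tape (List.reverse xs ++ blank ∷ l) blank []
      ts≡ = update-lookup i ts (trans eq (cong (λ l' → tape l' blank []) (ʳ++-defn xs)))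
      arith : ∀ n → 1 + (2 * n + 1 + 1) ≡ 2 * n + 3
      arith = solve-∀

    rewind-tabulate : ∀ i (ts : Tapes {a} {k}) {n} (f : Fin n → Symbol a) {l} →
      (∀ j → full (f j) ≡ true) → Vec.lookup ts i ≡ atEnd l (tabulate f) →
      Executes (rewind i) ts (2 * n + 3) (ts [ i ]≔ atStart l (tabulate f))
    rewind-tabulate i ts f full-f eq =
      weaken (≤-reflexive (cong (λ n → 2 * n + 3) (length-tabulate f)))
        (rewind-executes i ts (tabulate⁺ full-f) eq)

-- The alphabet and the five tapes of the decision procedure

Cell : Set
Cell = Symbol 8

-- Values up to 4 are told apart because the order of the graph is compared with 4.
clip : ℕ → Fin 8
clip 0 = 0F
clip 1 = 1F
clip 2 = 2F
clip 3 = 3F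
clip _ = 4F

sat : ℕ → Cell
sat n = aux (clip n)

increment : Cell → Cell
increment (aux 0F) = aux 1F
increment (aux 1F) = aux 2F
increment (aux 2F) = aux 3F
increment _        = aux 4F

increment-sat : ∀ n → increment (sat n) ≡ sat (suc n)
increment-sat 0 = refl
increment-sat 1 = refl
increment-sat 2 = refl
increment-sat 3 = refl
increment-sat (suc (suc (suc (suc n)))) = refl

isZero isOne : ℕ → Bool
isZero 0 = true
isZero _ = false
isOne 1 = true
isOne _ = false

satIsZero satIsOne : Cell → Bool
satIsZero (aux 0F) = true
satIsZero _        = false
satIsOne (aux 1F) = true
satIsOne _        = false

satIsZero-sat : ∀ n → satIsZero (sat n) ≡ isZero n
satIsZero-sat 0 = refl
satIsZero-sat 1 = refl
satIsZero-sat 2 = refl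
satIsZero-sat 3 = refl
satIsZero-sat (suc (suc (suc (suc n)))) = refl

satIsOne-sat : ∀ n → satIsOne (sat n) ≡ isOne n
satIsOne-sat 0 = refl
satIsOne-sat 1 = refl
satIsOne-sat 2 = refl
satIsOne-sat 3 = refl
satIsOne-sat (suc (suc (suc (suc n)))) = refl

isTrue : Cell → Bool
isTrue (bit b) = b
isTrue _       = false

-- The three flags kept in the last tape: some pair of distinct vertices does
-- not have exactly one walk of length 1 or 2; the answer is already negative;
-- the carry of the shift.
Flags : Set
Flags = Bool × Bool × Bool

flags : Flags → Cell
flags (false , false , false) = aux 0F
flags (false , false , true)  = aux 1F
flags (false , true  , false) = aux 2F
flags (false , true  , true)  = aux 3F
flags (true  , false , false) = aux 4F
flags (true  , false , true)  = aux 5F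
flags (true  , true  , false) = aux 6F
flags (true  , true  , true)  = aux 7F

readFlags : Cell → Flags
readFlags (aux 0F) = false , false , false
readFlags (aux 1F) = false , false , true
readFlags (aux 2F) = false , true  , false
readFlags (aux 3F) = false , true  , true
readFlags (aux 4F) = true  , false , false
readFlags (aux 5F) = true  , false , true
readFlags (aux 6F) = true  , true  , false
readFlags _        = true  , true  , true

readFlags-flags : ∀ x → readFlags (flags x) ≡ x
readFlags-flags (false , false , false) = refl
readFlags-flags (false , false , true)  = refl
readFlags-flags (false , true  , false) = refl
readFlags-flags (false , true  , true)  = refl
readFlags-flags (true  , false , false) = refl
readFlags-flags (true  , false , true)  = refl
readFlags-flags (true  , true  , false) = refl
readFlags-flags (true  , true  , true)  = refl

Prog : Set
Prog = Program {8} {4}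

register : Cell → Tape 8
register x = tape [] x []

-- Elementwise passes over the three vector tapes

Update : Set
Update = Cell → Cell → Cell → Cell → Cell × Cell × Cell × Cell

sweepAct : Update → Heads {8} {4} → Actions {8} {4}
sweepAct g (m ∷ s ∷ t ∷ u ∷ r ∷ []) with g s t u r
... | s' , t' , u' , r' =
  (m , stay) ∷ (s' , right) ∷ (t' , right) ∷ (u' , right) ∷ (r' , stay) ∷ []

rewindVectors : Prog
rewindVectors = rewind 1F ⨾ rewind 2F ⨾ rewind 3F

sweep : Update → Prog
sweep g = while (fullAt 3F) (perform (sweepAct g)) ⨾ rewindVectors

-- The register runs through the values ρ 0, …, ρ n.
sweep-loop : ∀ g {n} (s t u s' t' u' : Fin n → Cell) (ρ : ℕ → Cell) →
  (∀ i → full (u i) ≡ true) →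
  (∀ i → g (s i) (t i) (u i) (ρ (toℕ i)) ≡ (s' i , t' i , u' i , ρ (suc (toℕ i)))) →
  ∀ {m ls lt lu} →
  Executes {8} {4} (while (fullAt 3F) (perform (sweepAct g)))
    (m ∷ toTape ls (tabulate s ++ blank ∷ []) ∷ toTape lt (tabulate t ++ blank ∷ []) ∷
     toTape lu (tabulate u ++ blank ∷ []) ∷ register (ρ 0) ∷ [])
    (2 * n + 1)
    (m ∷ tape (tabulate s' ʳ++ ls) blank [] ∷ tape (tabulate t' ʳ++ lt) blank [] ∷
     tape (tabulate u' ʳ++ lu) blank [] ∷ register (ρ n) ∷ [])
sweep-loop g {zero} s t u s' t' u' ρ fu law = exit refl
sweep-loop g {suc n} s t u s' t' u' ρ fu law {m} {ls} {lt} {lu} =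
  weaken (≤-reflexive (arith n))
    (again (fu 0F) (performed moved)
      (sweep-loop g (s ∘ suc) (t ∘ suc) (u ∘ suc) (s' ∘ suc) (t' ∘ suc) (u' ∘ suc)
        (ρ ∘ suc) (fu ∘ suc) (law ∘ suc)))
  where
  arith : ∀ n → suc (1 + (2 * n + 1)) ≡ 2 * suc n + 1
  arith = solve-∀
  moved : act {8} {4} (sweepAct g)
    (m ∷ tape ls (s 0F) (tabulate (s ∘ suc) ++ blank ∷ []) ∷
         tape lt (t 0F) (tabulate (t ∘ suc) ++ blank ∷ []) ∷
         tape lu (u 0F) (tabulate (u ∘ suc) ++ blank ∷ []) ∷ register (ρ 0) ∷ [])
    ≡ (m ∷ toTape (s' 0F ∷ ls) (tabulate (s ∘ suc) ++ blank ∷ []) ∷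
           toTape (t' 0F ∷ lt) (tabulate (t ∘ suc) ++ blank ∷ []) ∷
           toTape (u' 0F ∷ lu) (tabulate (u ∘ suc) ++ blank ∷ []) ∷ register (ρ 1) ∷ [])
  moved rewrite law 0F
    | move-right ls (s' 0F) (tabulate (s ∘ suc) ++ blank ∷ [])
    | move-right lt (t' 0F) (tabulate (t ∘ suc) ++ blank ∷ [])
    | move-right lu (u' 0F) (tabulate (u ∘ suc) ++ blank ∷ []) = refl

-- The normal form of the tapes between two passes, with every vector rewound. The first tape is
-- arbitrary because elementwise passes leave it alone.
vectors : ∀ {n} → Tape 8 → (Fin n → Bool) → (Fin n → ℕ) → (Fin n → Bool) → Cell →
          Tapes {8} {4}
vectors m s t u r =
  m ∷ atStart [] (tabulate (bit ∘ s)) ∷ atStart [] (tabulate (sat ∘ t)) ∷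
  atStart [] (tabulate (bit ∘ u)) ∷ register r ∷ []

rewindVectors-executes : ∀ {n} (s : Fin n → Bool) (t : Fin n → ℕ) (u : Fin n → Bool) {m r} →
  Executes rewindVectors
    (m ∷ atEnd [] (tabulate (bit ∘ s)) ∷ atEnd [] (tabulate (sat ∘ t)) ∷
     atEnd [] (tabulate (bit ∘ u)) ∷ register r ∷ [])
    (6 * n + 9) (vectors m s t u r)
rewindVectors-executes {n} s t u {m} {r} =
  weaken (≤-reflexive (arith n))
    (rewind-tabulate 1F (m ∷ atEnd [] S ∷ atEnd [] T ∷ atEnd [] U ∷ register r ∷ [])
      (bit ∘ s) (λ _ → refl) refl
    then (rewind-tabulate 2F (m ∷ atStart [] S ∷ atEnd [] T ∷ atEnd [] U ∷ register r ∷ [])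
      (sat ∘ t) (λ _ → refl) refl
    then rewind-tabulate 3F (m ∷ atStart [] S ∷ atStart [] T ∷ atEnd [] U ∷ register r ∷ [])
      (bit ∘ u) (λ _ → refl) refl))
  where
  S = tabulate (bit ∘ s)
  T = tabulate (sat ∘ t)
  U = tabulate (bit ∘ u)
  arith : ∀ n → (2 * n + 3) + ((2 * n + 3) + (2 * n + 3)) ≡ 6 * n + 9
  arith = solve-∀

sweep-executes : ∀ g {n} {s : Fin n → Bool} {t : Fin n → ℕ} {u : Fin n → Bool}
  (s' : Fin n → Bool) (t' : Fin n → ℕ) (u' : Fin n → Bool) (ρ : ℕ → Cell) →
  (∀ i → g (bit (s i)) (sat (t i)) (bit (u i)) (ρ (toℕ i))
         ≡ (bit (s' i) , sat (t' i) , bit (u' i) , ρ (suc (toℕ i)))) →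
  ∀ {m} → Executes (sweep g) (vectors m s t u (ρ 0)) (8 * n + 10) (vectors m s' t' u' (ρ n))
sweep-executes g {n} {s} {t} {u} s' t' u' ρ law =
  weaken (≤-reflexive (arith n))
    (sweep-loop g (bit ∘ s) (sat ∘ t) (bit ∘ u) (bit ∘ s') (sat ∘ t') (bit ∘ u') ρ
       (λ _ → refl) law
     then rewindVectors-executes s' t' u')
  where
  arith : ∀ n → (2 * n + 1) + (6 * n + 9) ≡ 8 * n + 10
  arith = solve-∀

-- Multiplication of a vector by the adjacency matrix

count : ∀ {n} → (Fin n → Bool) → ℕ
count {zero}  p = 0
count {suc n} p = (if p zero then 1 else 0) + count (p ∘ suc)

scanAct : Heads {8} {4} → Actions {8} {4}
scanAct (m ∷ s ∷ t ∷ u ∷ r ∷ []) =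
  (m , right) ∷ (s , right) ∷
  ((if isTrue m ∧ isTrue s then increment t else t) , stay) ∷ (u , stay) ∷ (r , stay) ∷ []

-- The rows of the matrix have no separators. The blank behind `s` ends the scan, and the matrix
-- head then stands at the beginning of the next row.
scan : Prog
scan = while (fullAt 1F) (perform scanAct)

multiply : Prog
multiply = while (fullAt 2F) (scan ⨾ rewind 1F ⨾ perform (moveAt 2F right))
           ⨾ rewind 0F ⨾ rewind 2F

scan-executes : ∀ {n} (a s : Fin n → Bool) {l ls rest lt t rt u r} →
  Executes scan
    (toTape l (tabulate (bit ∘ a) ++ rest) ∷ toTape ls (tabulate (bit ∘ s) ++ blank ∷ []) ∷
     tape lt (sat t) rt ∷ u ∷ r ∷ [])
    (2 * n + 1)
    (toTape (tabulate (bit ∘ a) ʳ++ l) rest ∷ tape (tabulate (bit ∘ s) ʳ++ ls) blank [] ∷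
     tape lt (sat (t + count (λ i → a i ∧ s i))) rt ∷ u ∷ r ∷ [])
scan-executes {zero} a s {t = t} rewrite +-identityʳ t = exit refl
scan-executes {suc n} a s {l} {ls} {rest} {lt} {t} {rt} {u} {r} =
  weaken (≤-reflexive (arith n))
    (again refl (performed moved) 
      (to-≡ (cong (λ k → toTape (tabulate (bit ∘ a) ʳ++ l) rest ∷
                         tape (tabulate (bit ∘ s) ʳ++ ls) blank [] ∷
                         tape lt (sat k) rt ∷ u ∷ r ∷ []) (+-assoc t c _))
        (scan-executes (a ∘ suc) (s ∘ suc))))
  where
  arith : ∀ n → suc (1 + (2 * n + 1)) ≡ 2 * suc n + 1
  arith = solve-∀
  c = if a 0F ∧ s 0F then 1 else 0
  counted : (if a 0F ∧ s 0F then increment (sat t) else sat t) ≡ sat (t + c)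
  counted with a 0F ∧ s 0F
  ... | true  = trans (increment-sat t) (cong sat (+-comm 1 t))
  ... | false = cong sat (sym (+-identityʳ t))
  moved : act scanAct
    (tape l (bit (a 0F)) (tabulate (bit ∘ a ∘ suc) ++ rest) ∷
     tape ls (bit (s 0F)) (tabulate (bit ∘ s ∘ suc) ++ blank ∷ []) ∷
     tape lt (sat t) rt ∷ u ∷ r ∷ [])
    ≡ (toTape (bit (a 0F) ∷ l) (tabulate (bit ∘ a ∘ suc) ++ rest) ∷
       toTape (bit (s 0F) ∷ ls) (tabulate (bit ∘ s ∘ suc) ++ blank ∷ []) ∷
       tape lt (sat (t + c)) rt ∷ u ∷ r ∷ [])
  moved rewrite counted
    | move-right l (bit (a 0F)) (tabulate (bit ∘ a ∘ suc) ++ rest)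
    | move-right ls (bit (s 0F)) (tabulate (bit ∘ s ∘ suc) ++ blank ∷ []) = refl

rows : ∀ {m n} → (Fin m → Fin n → Bool) → List Cell
rows A = concat (tabulate (λ i → tabulate (bit ∘ A i)))

timesVector : ∀ {m n} → (Fin m → Fin n → Bool) → (Fin n → Bool) → (Fin m → ℕ) → Fin m → ℕ
timesVector A s t i = t i + count (λ j → A i j ∧ s j)

-- The matrix is rectangular because the induction strips off rows while `s` keeps its length.
multiply-loop : ∀ {m n} (A : Fin m → Fin n → Bool) (s : Fin n → Bool) (t : Fin m → ℕ)
  {l lt u r} →
  Executes (while (fullAt 2F) (scan ⨾ rewind 1F ⨾ perform (moveAt 2F right)))
    (toTape l (rows A ++ blank ∷ []) ∷ atStart [] (tabulate (bit ∘ s)) ∷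
     toTape lt (tabulate (sat ∘ t) ++ blank ∷ []) ∷ u ∷ r ∷ [])
    (m * (4 * n + 6) + 1)
    (tape (rows A ʳ++ l) blank [] ∷ atStart [] (tabulate (bit ∘ s)) ∷
     tape (tabulate (sat ∘ timesVector A s t) ʳ++ lt) blank [] ∷ u ∷ r ∷ [])
multiply-loop {zero}  A s t = exit refl
multiply-loop {suc m} {n} A s t {l} {lt} {u} {r} =
  weaken (≤-reflexive (arith m n))
    (again refl
      (from-≡ (cong (λ xs → toTape l xs ∷ _) (++-assoc row (rows (A ∘ suc)) (blank ∷ [])))
         (scan-executes (A 0F) s)
       then (rewind-tabulate 1F
          (toTape (row ʳ++ l) rest ∷ atEnd [] (tabulate (bit ∘ s)) ∷ tape lt t₀ ts ∷ u ∷ r ∷ [])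
          (bit ∘ s) (λ _ → refl) refl
       then performed moved))
      (to-≡ (cong (λ xs → tape xs blank [] ∷ _) (sym (++-ʳ++ row {rows (A ∘ suc)} {l})))
        (multiply-loop (A ∘ suc) s (t ∘ suc))))
  where
  row = tabulate (bit ∘ A 0F)
  rest = rows (A ∘ suc) ++ blank ∷ []
  t₀ = sat (timesVector A s t 0F)
  ts = tabulate (sat ∘ t ∘ suc) ++ blank ∷ []
  moved : act (moveAt 2F right)
    (toTape (row ʳ++ l) rest ∷ atStart [] (tabulate (bit ∘ s)) ∷ tape lt t₀ ts ∷ u ∷ r ∷ [])
    ≡ (toTape (row ʳ++ l) rest ∷ atStart [] (tabulate (bit ∘ s)) ∷ toTape (t₀ ∷ lt) ts ∷ u ∷ r ∷ [])
  moved rewrite move-right lt t₀ ts = refl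
  arith : ∀ m n → suc (((2 * n + 1) + ((2 * n + 3) + 1)) + (m * (4 * n + 6) + 1))
                  ≡ suc m * (4 * n + 6) + 1
  arith = solve-∀

length-rows : ∀ {m n} (A : Fin m → Fin n → Bool) → length (rows A) ≡ m * n
length-rows {zero}  A = refl
length-rows {suc m} A = trans (length-++ (tabulate (bit ∘ A 0F)))
  (cong₂ _+_ (length-tabulate (bit ∘ A 0F)) (length-rows (A ∘ suc)))
  where open import Data.List.Properties using (length-++)

Full-rows : ∀ {m n} (A : Fin m → Fin n → Bool) → Full (rows A)
Full-rows A = concat⁺ (tabulate⁺ (λ i → tabulate⁺ {f = bit ∘ A i} (λ _ → refl)))

multiply-executes : ∀ {n} (A : Fin n → Fin n → Bool) {s : Fin n → Bool} {t : Fin n → ℕ}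
  {u : Fin n → Bool} {l r} →
  Executes multiply (vectors (atStart l (rows A)) s t u r) (6 * (n * n) + 8 * n + 7)
                    (vectors (atStart l (rows A)) s (timesVector A s t) u r)
multiply-executes {n} A {s} {t} {u} {l} {r} =
  weaken (≤-reflexive (arith n))
    (multiply-loop A s t
    then (weaken (≤-reflexive (cong (λ k → 2 * k + 3) (length-rows A)))
      (rewind-executes 0F (atEnd l (rows A) ∷ S ∷ atEnd [] T ∷ U ∷ register r ∷ [])
            (Full-rows A) refl)
    then rewind-tabulate 2F (atStart l (rows A) ∷ S ∷ atEnd [] T ∷ U ∷ register r ∷ [])
            (sat ∘ timesVector A s t) (λ _ → refl) refl))
  where
  S = atStart [] (tabulate (bit ∘ s))
  T = tabulate (sat ∘ timesVector A s t)
  U = atStart [] (tabulate (bit ∘ u))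
  arith : ∀ n → (n * (4 * n + 6) + 1) + ((2 * (n * n) + 3) + (2 * n + 3)) ≡ 6 * (n * n) + 8 * n + 7
  arith = solve-∀

-- The decision procedure

setFound setBad : Bool → Cell → Cell
setFound x r with readFlags r
... | f , b , c = flags (f ∨ x , b , c)
setBad x r with readFlags r
... | f , b , c = flags (f , b ∨ x , c)

carryFlag : Cell → Bool
carryFlag r = proj₂ (proj₂ (readFlags r))

setCarry : Bool → Cell → Cell
setCarry x r with readFlags r
... | f , b , _ = flags (f , b , x)

-- `shift` moves the contents of `u` one cell onwards: through the carry, each cell receives the old
-- bit of its predecessor.
copyU bitsOfT recordPairs recordFar shift : Update
copyU       s t u r = u , aux 0F , u , r
bitsOfT     s t u r = bit (not (satIsZero t)) , t , u , r
recordPairs s t u r =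
  bit (not (satIsZero t)) , t , u , setFound (not (isTrue u) ∧ not (satIsOne t)) r
recordFar   s t u r = s , t , u , setBad (not (isTrue u) ∧ satIsZero t) r
shift       s t u r = s , t , bit (carryFlag r) , setCarry (isTrue u) r

-- The three multiplications turn `t` into the adjacency vector of the current vertex, then into the
-- numbers of walks of length 1 or 2 to it, then into numbers that vanish exactly where no walk of
-- length 1, 2 or 3 leads to it.
examineVertex : Prog
examineVertex =
  sweep copyU ⨾ multiply ⨾ sweep bitsOfT ⨾ multiply ⨾ sweep recordPairs ⨾ multiply ⨾
  sweep recordFar ⨾ sweep shift

-- At the outset `u` is zero and the carry is set, so the first shift creates the unit vector of the
-- first vertex. The loop ends when the 1 has been shifted out into the carry; for the null graph
-- this holds at once.
examineAll : Prog
examineAll = sweep shift ⨾ while (λ h → not (carryFlag (Vec.lookup h 4F))) examineVertex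

isFour : Cell → Bool
isFour (aux 4F) = true
isFour _        = false

enter countVertex settle : Heads {8} {4} → Actions {8} {4}
enter (m ∷ s ∷ t ∷ u ∷ r ∷ []) =
  (m , stay) ∷ (s , right) ∷ (t , right) ∷ (u , right) ∷ (aux 0F , stay) ∷ []
countVertex (m ∷ s ∷ t ∷ u ∷ r ∷ []) =
  (m , right) ∷ (bit false , right) ∷ (aux 0F , right) ∷ (bit false , right) ∷
  (increment r , stay) ∷ []
settle (m ∷ s ∷ t ∷ u ∷ r ∷ []) =
  (blank , right) ∷ (s , stay) ∷ (t , stay) ∷ (u , stay) ∷
  (flags (false , not (isFour r) , true) , stay) ∷ []

-- Each leading 1 of the input appends a zero to the three vector tapes and raises the counter in
-- the register. `settle` turns the separating 0 into the blank in front of the matrix, and the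
-- counter into the flag for fewer than four vertices; it also sets the carry for the first shift.
prepare : Prog
prepare =
  perform enter ⨾ while (λ h → isTrue (Vec.lookup h 0F)) (perform countVertex) ⨾
  rewindVectors ⨾ perform settle ⨾
  -- The trip past the last entry leaves an explicit blank behind the matrix.
  while (fullAt 0F) (perform (moveAt 0F right)) ⨾ rewind 0F

-- Effect of the elementwise passes

-- Prefix disjunctions are the values that a flag runs through during a pass.
anyBelow : ∀ {n} → (Fin n → Bool) → ℕ → Bool
anyBelow {zero}  p _       = false
anyBelow {suc n} p zero    = false
anyBelow {suc n} p (suc i) = p zero ∨ anyBelow (p ∘ suc) i

anyBelow-zero : ∀ {n} (p : Fin n → Bool) → anyBelow p 0 ≡ false
anyBelow-zero {zero}  p = refl
anyBelow-zero {suc n} p = refl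

anyBelow-suc : ∀ {n} (p : Fin n → Bool) i → anyBelow p (suc (toℕ i)) ≡ anyBelow p (toℕ i) ∨ p i
anyBelow-suc {suc n} p zero = trans (cong (p zero ∨_) (anyBelow-zero (p ∘ suc))) (∨-identityʳ _)
anyBelow-suc {suc n} p (suc i) =
  trans (cong (p zero ∨_) (anyBelow-suc (p ∘ suc) i)) (sym (∨-assoc (p zero) _ _))

any : ∀ {n} → (Fin n → Bool) → Bool
any {n} p = anyBelow p n

anyFrom : ℕ → ℕ → (ℕ → Bool) → Bool
anyFrom k zero    p = false
anyFrom k (suc j) p = p k ∨ anyFrom (suc k) j p

≡ᵇ-refl : ∀ k → (k ≡ᵇ k) ≡ true
≡ᵇ-refl zero    = refl
≡ᵇ-refl (suc k) = ≡ᵇ-refl k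

-- The position is a number rather than a vertex: after the last shift it equals `n`, and the vector
-- is zero.
unit : ∀ {n} → ℕ → Fin n → Bool
unit k i = toℕ i ≡ᵇ k

module _ {n} {m : Tape 8} {s : Fin n → Bool} {t : Fin n → ℕ} where

  copyU-executes : ∀ {u r} → Executes (sweep copyU) (vectors m s t u r) (8 * n + 10)
                                      (vectors m u (const 0) u r)
  copyU-executes {u} {r} = sweep-executes copyU u (const 0) u (const r) (λ _ → refl)

  bitsOfT-executes : ∀ {u r} → Executes (sweep bitsOfT) (vectors m s t u r) (8 * n + 10)
                                        (vectors m (not ∘ isZero ∘ t) t u r)
  bitsOfT-executes {u} {r} = sweep-executes bitsOfT _ t u (const r)
    (λ i → cong (λ b → bit (not b) , sat (t i) , bit (u i) , r) (satIsZero-sat (t i)))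

  recordPairs-executes : ∀ {u f b c} →
    Executes (sweep recordPairs) (vectors m s t u (flags (f , b , c))) (8 * n + 10)
      (vectors m (not ∘ isZero ∘ t) t u
        (flags (f ∨ any (λ i → not (u i) ∧ not (isOne (t i))) , b , c)))
  recordPairs-executes {u} {f} {b} {c} =
    from-≡ (cong (λ x → vectors m s t u (flags (x , b , c)))
             (sym (trans (cong (f ∨_) (anyBelow-zero p)) (∨-identityʳ f))))
      (sweep-executes recordPairs _ t u ρ law)
    where
    p : Fin n → Bool
    p i = not (u i) ∧ not (isOne (t i))
    ρ : ℕ → Cell
    ρ i = flags (f ∨ anyBelow p i , b , c)
    law : ∀ i → recordPairs (bit (s i)) (sat (t i)) (bit (u i)) (ρ (toℕ i))
                ≡ (bit (not (isZero (t i))) , sat (t i) , bit (u i) , ρ (suc (toℕ i)))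
    law i rewrite satIsZero-sat (t i) | satIsOne-sat (t i)
                | readFlags-flags (f ∨ anyBelow p (toℕ i) , b , c)
                | anyBelow-suc p i | ∨-assoc f (anyBelow p (toℕ i)) (p i) = refl

  recordFar-executes : ∀ {u f b c} →
    Executes (sweep recordFar) (vectors m s t u (flags (f , b , c))) (8 * n + 10)
      (vectors m s t u (flags (f , b ∨ any (λ i → not (u i) ∧ isZero (t i)) , c)))
  recordFar-executes {u} {f} {b} {c} =
    from-≡ (cong (λ x → vectors m s t u (flags (f , x , c)))
             (sym (trans (cong (b ∨_) (anyBelow-zero p)) (∨-identityʳ b))))
      (sweep-executes recordFar s t u ρ law)
    where
    p : Fin n → Bool
    p i = not (u i) ∧ isZero (t i)
    ρ : ℕ → Cell
    ρ i = flags (f , b ∨ anyBelow p i , c)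
    law : ∀ i → recordFar (bit (s i)) (sat (t i)) (bit (u i)) (ρ (toℕ i))
                ≡ (bit (s i) , sat (t i) , bit (u i) , ρ (suc (toℕ i)))
    law i rewrite satIsZero-sat (t i)
                | readFlags-flags (f , b ∨ anyBelow p (toℕ i) , c)
                | anyBelow-suc p i | ∨-assoc b (anyBelow p (toℕ i)) (p i) = refl

  -- The carry before the i-th step says whether i is the new position of the 1.
  shift-executes : ∀ {u f b} k → (∀ i → u i ≡ (suc (toℕ i) ≡ᵇ k)) →
    Executes (sweep shift) (vectors m s t u (flags (f , b , (0 ≡ᵇ k)))) (8 * n + 10)
      (vectors m s t (unit k) (flags (f , b , (n ≡ᵇ k))))
  shift-executes {u} {f} {b} k eq =
    sweep-executes shift s t (unit k) ρ law
    where
    ρ : ℕ → Cell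
    ρ i = flags (f , b , (i ≡ᵇ k))
    law : ∀ i → shift (bit (s i)) (sat (t i)) (bit (u i)) (ρ (toℕ i))
                ≡ (bit (s i) , sat (t i) , bit (unit k i) , ρ (suc (toℕ i)))
    law i rewrite readFlags-flags (f , b , (toℕ i ≡ᵇ k)) | eq i = refl

-- Examination of all vertices

module _ {n} (A : Fin n → Fin n → Bool) where

  -- The entries of `walks₁` are 0 or 1, so passing to its support loses nothing and `walks₂` is an
  -- exact count. `walks₃` is no such count, but only its zeros matter.
  walks₁ walks₂ walks₃ : ℕ → Fin n → ℕ
  walks₁ k = timesVector A (unit k) (const 0)
  walks₂ k = timesVector A (not ∘ isZero ∘ walks₁ k) (walks₁ k)
  walks₃ k = timesVector A (not ∘ isZero ∘ walks₂ k) (walks₂ k)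

  notOne tooFar : ℕ → Fin n → Bool
  notOne k i = not (unit k i) ∧ not (isOne (walks₂ k i))
  tooFar k i = not (unit k i) ∧ isZero (walks₃ k i)

  module _ {l : List Cell} where

    adjacency : Tape 8
    adjacency = atStart l (rows A)

    examineVertex-executes : ∀ {s t f b} k →
      Executes examineVertex (vectors adjacency s t (unit k) (flags (f , b , false)))
        (18 * (n * n) + 64 * n + 71)
        (vectors adjacency (not ∘ isZero ∘ walks₂ k) (walks₃ k) (unit (suc k))
          (flags (f ∨ any (notOne k) , b ∨ any (tooFar k) , (n ≡ᵇ suc k))))
    examineVertex-executes k = weaken (≤-reflexive (arith n))
      (copyU-executes then (multiply-executes A then (bitsOfT-executes
      then (multiply-executes A then (recordPairs-executes then (multiply-executes A
      then (recordFar-executes then shift-executes (suc k) (λ _ → refl))))))))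
      where
      arith : ∀ n → let x = 8 * n + 10 ; y = 6 * (n * n) + 8 * n + 7 in
              x + (y + (x + (y + (x + (y + (x + x)))))) ≡ 18 * (n * n) + 64 * n + 71
      arith = solve-∀

    -- Induction on the number `j` of vertices still to be examined. The final tapes stay
    -- existential because the answer depends on the flags alone.
    examine-loop : ∀ {s t f b} j k → k + j ≡ n → ∃[ ts ]
      Executes (while (λ h → not (carryFlag (Vec.lookup h 4F))) examineVertex)
        (vectors adjacency s t (unit k) (flags (f , b , (n ≡ᵇ k))))
        (j * (18 * (n * n) + 64 * n + 72) + 1) ts ×
      readFlags (Vec.lookup (Vec.map head ts) 4F)
        ≡ (f ∨ anyFrom k j (any ∘ notOne) , b ∨ anyFrom k j (any ∘ tooFar) , true)
    examine-loop {s} {t} {f} {b} zero k refl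
      rewrite +-identityʳ k | ≡ᵇ-refl k | ∨-identityʳ f | ∨-identityʳ b =
      _ , exit (cong (λ x → not (proj₂ (proj₂ x))) (readFlags-flags (f , b , true))) ,
      readFlags-flags (f , b , true)
    examine-loop {s} {t} {f} {b} (suc j) k eq
      with examine-loop {not ∘ isZero ∘ walks₂ k} {walks₃ k} {f ∨ any (notOne k)} {b ∨ any (tooFar k)}
             j (suc k) (trans (sym (+-suc k j)) eq)
    ... | ts , d , eq' = ts ,
      weaken (≤-reflexive (arith j (18 * (n * n) + 64 * n)))
        (from-≡ (cong (λ c → vectors adjacency s t (unit k) (flags (f , b , c))) no-carry)
          (again (cong (λ x → not (proj₂ (proj₂ x))) (readFlags-flags (f , b , false)))
                 (examineVertex-executes k) d)) ,
      trans eq' (cong₂ (λ x y → x , y , true) (∨-assoc f _ _) (∨-assoc b _ _))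
      where
      arith : ∀ j x → suc ((x + 71) + (j * (x + 72) + 1)) ≡ suc j * (x + 72) + 1
      arith = solve-∀
      +-suc-≢ᵇ : ∀ k j → (k + suc j ≡ᵇ k) ≡ false
      +-suc-≢ᵇ zero    j = refl
      +-suc-≢ᵇ (suc k) j = +-suc-≢ᵇ k j
      no-carry : (n ≡ᵇ k) ≡ false
      no-carry = trans (cong (_≡ᵇ k) (sym eq)) (+-suc-≢ᵇ k j)

    examineAll-executes : ∀ {s t b} → ∃[ ts ]
      Executes examineAll (vectors adjacency s t (const false) (flags (false , b , true)))
        (8 * n + 10 + (n * (18 * (n * n) + 64 * n + 72) + 1)) ts ×
      readFlags (Vec.lookup (Vec.map head ts) 4F)
        ≡ (anyFrom 0 n (any ∘ notOne) , b ∨ anyFrom 0 n (any ∘ tooFar) , true)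
    examineAll-executes with examine-loop n 0 refl
    ... | ts , d , eq = ts , (shift-executes 0 (λ _ → refl) then d) , eq

-- Reading the input

isFour-sat : ∀ n → not (isFour (sat n)) ≡ (n <ᵇ 4)
isFour-sat 0 = refl
isFour-sat 1 = refl
isFour-sat 2 = refl
isFour-sat 3 = refl
isFour-sat (suc (suc (suc (suc _)))) = refl

countVertex-loop : ∀ n {l x rest ls lt lu c} → isTrue x ≡ false →
  Executes (while (λ h → isTrue (Vec.lookup h 0F)) (perform countVertex))
    (toTape l (replicate n (bit true) ++ x ∷ rest) ∷ tape ls blank [] ∷ tape lt blank [] ∷
     tape lu blank [] ∷ register (sat c) ∷ [])
    (2 * n + 1)
    (tape (replicate n (bit true) ʳ++ l) x rest ∷
     tape (tabulate {n = n} (const (bit false)) ʳ++ ls) blank [] ∷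
     tape (tabulate {n = n} (const (sat 0)) ʳ++ lt) blank [] ∷
     tape (tabulate {n = n} (const (bit false)) ʳ++ lu) blank [] ∷ register (sat (c + n)) ∷ [])
countVertex-loop zero {c = c} end rewrite +-identityʳ c = exit end
countVertex-loop (suc n) {l} {x} {rest} {ls} {lt} {lu} {c} end rewrite +-suc c n =
  weaken (≤-reflexive (arith n)) (again refl (performed moved) (countVertex-loop n {c = suc c} end))
  where
  arith : ∀ n → suc (1 + (2 * n + 1)) ≡ 2 * suc n + 1
  arith = solve-∀
  moved : act countVertex
    (tape l (bit true) (replicate n (bit true) ++ x ∷ rest) ∷ tape ls blank [] ∷ tape lt blank [] ∷
     tape lu blank [] ∷ register (sat c) ∷ [])
    ≡ (toTape (bit true ∷ l) (replicate n (bit true) ++ x ∷ rest) ∷ tape (bit false ∷ ls) blank [] ∷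
       tape (sat 0 ∷ lt) blank [] ∷ tape (bit false ∷ lu) blank [] ∷ register (sat (suc c)) ∷ [])
  moved rewrite increment-sat c | move-right l (bit true) (replicate n (bit true) ++ x ∷ rest) = refl

rightwards : ∀ xs {l ts} → Full xs →
  Executes {8} {4} (while (fullAt 0F) (perform (moveAt 0F right)))
    (toTape l xs ∷ ts) (2 * length xs + 1) (tape (xs ʳ++ l) blank [] ∷ ts)
rightwards [] [] = exit refl
rightwards (x ∷ xs) {l} {ts} (fx ∷ fs) = weaken (≤-reflexive (arith (length xs)))
  (again fx (performed (trans (act-moveAt 0F right (tape l x xs ∷ ts))
                              (cong (_∷ ts) (move-right l x xs))))
         (rightwards xs fs))
  where
  arith : ∀ n → suc (1 + (2 * n + 1)) ≡ 2 * suc n + 1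
  arith = solve-∀

prepare-executes : ∀ {n} (A : Fin n → Fin n → Bool) →
  Executes prepare
    (toTape [] (replicate n (bit true) ++ bit false ∷ rows A) ∷ Vec.replicate 4 emptyTape)
    (4 * (n * n) + 8 * n + 16)
    (vectors {n} (atStart (replicate n (bit true) ʳ++ []) (rows A)) (const false) (const 0)
      (const false) (flags (false , (n <ᵇ 4) , true)))
prepare-executes {n} A = weaken (≤-reflexive (arith n))
  (performed enter-acts
  then (countVertex-loop n {c = 0} refl
  then (rewindVectors-executes {n} (const false) (const 0) (const false)
  then (performed settle-acts
  then (weaken (≤-reflexive (cong (λ k → 2 * k + 1) (length-rows A)))
         (rightwards (rows A) (Full-rows A))
  then weaken (≤-reflexive (cong (λ k → 2 * k + 3) (length-rows A)))
         (rewind-executes 0F (atEnd ones (rows A) ∷ rest) (Full-rows A) refl))))))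
  where
  arith : ∀ n → 1 + ((2 * n + 1) + ((6 * n + 9) + (1 + ((2 * (n * n) + 1) + (2 * (n * n) + 3)))))
                ≡ 4 * (n * n) + 8 * n + 16
  arith = solve-∀
  ones = replicate n (bit true) ʳ++ []
  input = replicate n (bit true) ++ bit false ∷ rows A
  S = atStart [] (tabulate {n = n} (const (bit false)))
  T = atStart [] (tabulate {n = n} (const (sat 0)))
  rest : Vec (Tape 8) 4
  rest = S ∷ T ∷ S ∷ register (flags (false , (n <ᵇ 4) , true)) ∷ []
  enter-acts : act enter (toTape [] input ∷ Vec.replicate 4 emptyTape)
    ≡ toTape [] input ∷ tape (blank ∷ []) blank [] ∷ tape (blank ∷ []) blank [] ∷
      tape (blank ∷ []) blank [] ∷ register (sat 0) ∷ []
  enter-acts = refl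
  settle-acts : act settle (tape ones (bit false) (rows A) ∷ S ∷ T ∷ S ∷ register (sat n) ∷ [])
    ≡ toTape (blank ∷ ones) (rows A) ∷ rest
  settle-acts rewrite move-right ones blank (rows A) | isFour-sat n = refl

-- Short walks, distances and diameters

module _ {n : ℕ} where

  Edge : Graph n → Fin n → Fin n → Set
  Edge G u v = adj G u v ≡ true

  edge? : ∀ G u v → Dec (Edge G u v)
  edge? G u v = adj G u v ≟ᵇ true

  edge-sym : ∀ G {u v} → Edge G u v → Edge G v u
  edge-sym G {u} {v} e = trans (adj-sym G v u) e

  edge-≢ : ∀ G {u v} → Edge G u v → u ≢ v
  edge-≢ G {u} e refl with trans (sym e) (no-loop G u)
  ... | ()

  -- Bounded walks are easily joined, and decidable by recursion on the bound. `Walk→Path` recovers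
  -- paths from them, and with paths the distances.
  Short : Graph n → ℕ → Fin n → Fin n → Set
  Short G k u v = Σ (Walk G u v) λ p → edgeCount p ≤ k

  _▸_ : ∀ {G k u v w} → Edge G u v → Short G k v w → Short G (suc k) u w
  e ▸ (p , p≤k) = step e p , s≤s p≤k

  infixr 5 _▸_

  done : ∀ {G k u} → Short G k u u
  done = stop , z≤n

  Short-mono : ∀ {G j k u v} → j ≤ k → Short G j u v → Short G k u v
  Short-mono j≤k (p , p≤j) = p , ≤-trans p≤j j≤k

  Short-snoc : ∀ {G k u v w} → Short G k u v → Edge G v w → Short G (suc k) u w
  Short-snoc (stop , _) e           = e ▸ done
  Short-snoc (step e p , s≤s p≤k) f = e ▸ Short-snoc (p , p≤k) f

  Short-sym : ∀ {G k u v} → Short G k u v → Short G k v u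
  Short-sym (stop , _)             = done
  Short-sym {G} (step e p , s≤s p≤k) = Short-snoc (Short-sym (p , p≤k)) (edge-sym G e)

  Short-⊆ : ∀ {G H : Graph n} {k u v} → (∀ {u v} → Edge G u v → Edge H u v) →
            Short G k u v → Short H k u v
  Short-⊆ G⊆H (stop , _)           = done
  Short-⊆ G⊆H (step e p , s≤s p≤k) = G⊆H e ▸ Short-⊆ G⊆H (p , p≤k)

  short? : ∀ G k u v → Dec (Short G k u v)
  short? G zero u v = map′ (λ { refl → done }) (λ { (stop , _) → refl }) (u ≟ v)
  short? G (suc k) u v =
    map′ [ (λ { refl → done }) , (λ { (_ , e , w) → e ▸ w }) ]′
         (λ { (stop , _) → inj₁ refl ; (step e p , s≤s p≤k) → inj₂ (_ , e , p , p≤k) })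
         (u ≟ v ⊎-dec any? (λ w → edge? G u w ×-dec short? G k w v))

  suffix : ∀ {G : Graph n} {u v w} (p : Walk G v w) → Unique (vertices p) → u ∈ vertices p →
           Σ (Path G u w) λ q → edgeCount (proj₁ q) ≤ edgeCount p
  suffix p@stop       uniq (here refl) = (p , uniq) , ≤-refl
  suffix p@(step _ _) uniq (here refl) = (p , uniq) , ≤-refl
  suffix (step _ p) (_ ∷ uniq) (there u∈p) = map₂ m≤n⇒m≤1+n (suffix p uniq u∈p)

  -- Loop erasure: if the first vertex recurs on the path built for the rest, only the part from
  -- that recurrence on is kept.
  Walk→Path : ∀ {G u v} (p : Walk G u v) → Σ (Path G u v) λ q → edgeCount (proj₁ q) ≤ edgeCount p
  Walk→Path stop = (stop , [] ∷ []) , z≤n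
  Walk→Path {u = u} (step e p) with Walk→Path p
  ... | (q , uniq) , q≤p with _∈?_ _≟_ u (vertices q)
  ...   | yes u∈q = map₂ (λ r → m≤n⇒m≤1+n (≤-trans r q≤p)) (suffix q uniq u∈q)
  ...   | no  u∉q = (step e q , ¬Any⇒All¬ _ u∉q ∷ uniq) , s≤s q≤p

  Dist-intro : ∀ {G u v k} → Short G k u v → (∀ {j} → j < k → ¬ Short G j u v) → Dist G u v k
  Dist-intro {k = k} (p , p≤k) minimal with Walk→Path p
  ... | q , q≤p = (q , ≤-antisym (≤-trans q≤p p≤k) (least (proj₁ q))) , least ∘ proj₁
    where
    least : ∀ r → k ≤ edgeCount r
    least r = ≮⇒≥ λ r<k → minimal r<k (r , ≤-refl)

  Short→Dist : ∀ G {u v} k → Short G k u v → ∃[ j ] Dist G u v j × j ≤ k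
  Short→Dist G zero w = 0 , Dist-intro w (λ ()) , z≤n
  Short→Dist G {u} {v} (suc k) w with short? G k u v
  ... | yes w' = map₂ (map₂ m≤n⇒m≤1+n) (Short→Dist G k w')
  ... | no ¬w' = suc k , Dist-intro w (λ j<1+k → ¬w' ∘ Short-mono (m<1+n⇒m≤n j<1+k)) , ≤-refl

  -- Equivalent to connectedness together with diameter 3.
  Diameter₃ : Graph n → Set
  Diameter₃ G = (∀ u v → Short G 3 u v) × ∃₂ λ u v → ¬ Short G 2 u v

  Diameter₃-sound : ∀ {G} → Diameter₃ G → Connected G × Diameter G 3
  Diameter₃-sound {G} (near , u , v , far) =
    (nonZero u , λ x y → proj₁ (Walk→Path (proj₁ (near x y)))) ,
    (λ x y → Short→Dist G 3 (near x y)) ,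
    u , v , Dist-intro (near u v) (λ j<3 → far ∘ Short-mono (≤-pred j<3))
    where
    nonZero : ∀ {m} → Fin m → NonZero m
    nonZero zero    = _
    nonZero (suc _) = _

  Diameter₃-complete : ∀ {G} → Diameter G 3 → Diameter₃ G
  Diameter₃-complete {G} (near , u , v , _ , far) =
    (λ x y → let (_ , (((p , _) , eq) , _) , k≤3) = near x y in p , ≤-trans (≤-reflexive eq) k≤3) ,
    u , v , λ (p , p≤2) → let (q , q≤p) = Walk→Path p in
      n≮n 2 (≤-trans (far q) (≤-trans q≤p p≤2))

  Diameter₃-cong : ∀ {G H} → (∀ {u v} → Edge G u v → Edge H u v) →
                   (∀ {u v} → Edge H u v → Edge G u v) → Diameter₃ G → Diameter₃ H
  Diameter₃-cong G⊆H H⊆G (near , u , v , far) =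
    (λ x y → Short-⊆ G⊆H (near x y)) , u , v , far ∘ Short-⊆ H⊆G

  -- Removing one edge

  Joins : Fin n → Fin n → Fin n → Fin n → Set
  Joins u v x y = (x ≡ u × y ≡ v) ⊎ (x ≡ v × y ≡ u)

  joins? : ∀ u v x y → Dec (Joins u v x y)
  joins? u v x y = (x ≟ u ×-dec y ≟ v) ⊎-dec (x ≟ v ×-dec y ≟ u)

  Joins-swap : ∀ {u v x y} → Joins u v x y → Joins u v y x
  Joins-swap (inj₁ (p , q)) = inj₂ (q , p)
  Joins-swap (inj₂ (p , q)) = inj₁ (q , p)

  -- The graph without the edge `uv` is described through its edges, which avoids equality of
  -- `Graph` records.
  record _≅_-_—_ (H G : Graph n) (u v : Fin n) : Set where
    field
      kept    : ∀ {x y} → Edge H x y → Edge G x y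
      removed : ∀ {x y} → Edge H x y → ¬ Joins u v x y
      intact  : ∀ {x y} → Edge G x y → ¬ Joins u v x y → Edge H x y

    near : ∀ {x y} → Edge G x y → Edge H x y ⊎ Joins u v x y
    near {x} {y} e with joins? u v x y
    ... | yes j = inj₂ j
    ... | no ¬j = inj₁ (intact e ¬j)

  fromDec : ∀ (E : Fin n → Fin n → Set) → (∀ u v → Dec (E u v)) →
            (∀ {u v} → E u v → E v u) → (∀ {u} → ¬ E u u) →
            Σ (Graph n) λ H → (∀ {u v} → E u v → Edge H u v) × (∀ {u v} → Edge H u v → E u v)
  fromDec E E? sym-E irr-E = H , (λ {u} {v} → dec-true (E? u v)) , (λ {u} {v} → does⇒ (E? u v))
    where
    does⇒ : ∀ {P : Set} (P? : Dec P) → does P? ≡ true → P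
    does⇒ (yes p) _ = p
    H : Graph n
    H .adj u v = does (E? u v)
    H .adj-sym u v with E? u v
    ... | yes e = sym (dec-true (E? v u) (sym-E e))
    ... | no ¬e = sym (dec-false (E? v u) (¬e ∘ sym-E))
    H .no-loop u = dec-false (E? u u) irr-E

  removeEdge : ∀ G u v → Σ (Graph n) λ H → H ≅ G - u — v
  removeEdge G u v with fromDec (λ x y → Edge G x y × ¬ Joins u v x y)
    (λ x y → edge? G x y ×-dec ¬? (joins? u v x y))
    (λ (e , ¬j) → edge-sym G e , ¬j ∘ Joins-swap) (λ (e , _) → edge-≢ G e refl)
  ... | H , to , from = H , record
    { kept = proj₁ ∘ from ; removed = proj₂ ∘ from ; intact = λ e ¬j → to (e , ¬j) }

  -- Triangles and four-cycles

  Triangle : Graph n → Fin n → Fin n → Fin n → Set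
  Triangle G u v w = Edge G u v × Edge G u w × Edge G w v

  -- The vertices in cyclic order are `u`, `w`, `v`, `w'`. The two inequalities concern the
  -- diagonals; neighbours differ because there are no loops.
  FourCycle : Graph n → Fin n → Fin n → Fin n → Fin n → Set
  FourCycle G u w v w' =
    (Edge G u w × Edge G w v × Edge G u w' × Edge G w' v) × u ≢ v × w ≢ w'

  Cyclic : Graph n → Set
  Cyclic G = (∃[ u ] ∃[ v ] ∃[ w ] Triangle G u v w)
           ⊎ (∃[ u ] ∃[ w ] ∃[ v ] ∃[ w' ] FourCycle G u w v w')

  cyclic? : ∀ G → Dec (Cyclic G)
  cyclic? G =
    any? (λ u → any? λ v → any? λ w → edge? G u v ×-dec edge? G u w ×-dec edge? G w v) ⊎-dec
    any? (λ u → any? λ w → any? λ v → any? λ w' →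
      (edge? G u w ×-dec edge? G w v ×-dec edge? G u w' ×-dec edge? G w' v) ×-dec
      ¬? (u ≟ v) ×-dec ¬? (w ≟ w'))

  -- A walk of length at most 2 that uses `uv` once is repaired by the detour through `w`, which is
  -- one edge longer. A walk that uses it twice goes there and back, so its ends coincide.
  triangle-removal : ∀ {G H u v w} → H ≅ G - u — v → Triangle G u v w →
    (∀ x y → Short G 2 x y) → ∀ x y → Short H 3 x y
  triangle-removal {G} {H} {u} {v} {w} H≅ (uv , uw , wv) near₂ x y = detoured (near₂ x y)
    where
    open _≅_-_—_ H≅
    uw' : Edge H u w
    uw' = intact uw λ { (inj₁ (_ , refl)) → edge-≢ G wv refl ; (inj₂ (refl , _)) → edge-≢ G uv refl }
    wv' : Edge H w v
    wv' = intact wv λ { (inj₁ (refl , _)) → edge-≢ G uw refl ; (inj₂ (refl , refl)) → edge-≢ G uv refl }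
    around : ∀ {x y} → Joins u v x y → Short H 2 x y
    around (inj₁ (refl , refl)) = uw' ▸ wv' ▸ done
    around (inj₂ (refl , refl)) = edge-sym H wv' ▸ edge-sym H uw' ▸ done
    back : ∀ {x y z} → Joins u v x z → Joins u v z y → x ≡ y
    back (inj₁ (refl , refl)) (inj₁ (refl , refl)) = refl
    back (inj₁ (refl , refl)) (inj₂ (refl , refl)) = refl
    back (inj₂ (refl , refl)) (inj₁ (refl , refl)) = refl
    back (inj₂ (refl , refl)) (inj₂ (refl , refl)) = refl
    detoured : ∀ {x y} → Short G 2 x y → Short H 3 x y
    detoured (stop , _) = done
    detoured (step e stop , _) with near e
    ... | inj₁ e' = e' ▸ done
    ... | inj₂ j  = Short-mono (s≤s (s≤s z≤n)) (around j)
    detoured (step e (step f stop) , _) with near e | near f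
    ... | inj₁ e' | inj₁ f' = e' ▸ f' ▸ done
    ... | inj₁ e' | inj₂ j  = e' ▸ around j
    ... | inj₂ j  | inj₁ f' = Short-snoc (around j) f'
    ... | inj₂ i  | inj₂ j  = subst (Short H 3 _) (back i j) done
    detoured (step _ (step _ (step _ _)) , s≤s (s≤s ()))

  -- The other three edges of the cycle join `u` and `w`, and a two-edge walk between these would
  -- complete a triangle on `uw`. A walk p-s-y whose first edge is removed is replaced by the cycle
  -- edge pq and a walk of length at most 2 from q to y.
  fourCycle-removal : ∀ {G H u w v w'} → H ≅ G - u — w → FourCycle G u w v w' →
    (∀ z → ¬ Triangle G u w z) → (∀ x y → Short G 2 x y) → Diameter₃ H
  fourCycle-removal {G} {H} {u} {w} {v} {w'} H≅ ((uw , wv , uw' , w'v) , u≢v , w≢w') noTriangle near₂ =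
    (λ x y → detoured (near₂ x y)) , u , w , far
    where
    open _≅_-_—_ H≅
    -- p–q–r–s is the path in H that replaces the edge p–s.
    detour : ∀ {p q r s} → (∀ {x y} → Joins u w x y → Joins p s x y) →
      Edge G p s → Edge G p q → Edge G s r → q ≢ s → p ≢ r →
      ∀ {y} → Edge G s y → Short H 3 p y
    detour {p} {q} {r} {s} joins ps pq sr q≢s p≢r {y} sy = along (near₂ q y)
      where
      pq' : Edge H p q
      pq' = intact pq (λ j → go (joins j))
        where
        go : ¬ Joins p s p q
        go (inj₁ (_ , q≡s)) = q≢s q≡s
        go (inj₂ (p≡s , _)) = edge-≢ G ps p≡s
      -- `q` differs from both ends of the removed edge, so all edges at `q` survive.
      from-q : ∀ {z} → Edge G q z → Edge H q z
      from-q qz = intact qz (λ j → go (joins j))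
        where
        go : ¬ Joins p s q _
        go (inj₁ (q≡p , _)) = edge-≢ G pq (sym q≡p)
        go (inj₂ (q≡s , _)) = q≢s q≡s
      along : Short G 2 q y → Short H 3 p y
      along (stop , _) = pq' ▸ done
      along (step e stop , _) = pq' ▸ from-q e ▸ done
      along (step e (step f stop) , _) with near f
      ... | inj₁ f' = pq' ▸ from-q e ▸ f' ▸ done
      -- If the last edge is the removed one, then `y` is `s`, against the edge `sy`, or `y` is `p`,
      -- where the empty walk suffices.
      ... | inj₂ j with joins j
      ...   | inj₁ (_ , refl) = contradiction refl (edge-≢ G sy)
      ...   | inj₂ (_ , refl) = done
      along (step _ (step _ (step _ _)) , s≤s (s≤s ()))
    across : Short H 3 u w
    across = intact uw' (λ { (inj₁ (_ , refl)) → w≢w' refl ; (inj₂ (refl , _)) → edge-≢ G uw refl })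
      ▸ intact w'v (λ { (inj₁ (refl , _)) → edge-≢ G uw' refl ; (inj₂ (refl , _)) → w≢w' refl })
      ▸ intact (edge-sym G wv) (λ { (inj₁ (refl , _)) → u≢v refl ; (inj₂ (refl , _)) → edge-≢ G wv refl })
      ▸ done
    beyond : ∀ {x z y} → Joins u w x z → Edge G z y → Short H 3 x y
    beyond (inj₁ (refl , refl)) zy = detour (λ j → j) uw uw' wv (w≢w' ∘ sym) u≢v zy
    beyond (inj₂ (refl , refl)) zy = detour swap (edge-sym G uw) wv uw' (u≢v ∘ sym) w≢w' zy
    detoured : ∀ {x y} → Short G 2 x y → Short H 3 x y
    detoured (stop , _) = done
    detoured (step e stop , _) with near e
    ... | inj₁ e' = e' ▸ done
    ... | inj₂ (inj₁ (refl , refl)) = across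
    ... | inj₂ (inj₂ (refl , refl)) = Short-sym across
    detoured (step e (step f stop) , _) with near e | near f
    ... | inj₁ e' | inj₁ f' = e' ▸ f' ▸ done
    ... | inj₂ j  | _       = beyond j f
    ... | _       | inj₂ j  = Short-sym (beyond (Joins-swap j) (edge-sym G e))
    detoured (step _ (step _ (step _ _)) , s≤s (s≤s ()))
    far : ¬ Short H 2 u w
    far (stop , _)            = edge-≢ G uw refl
    far (step e stop , _)     = removed e (inj₁ (refl , refl))
    far (step e (step f stop) , _) = noTriangle _ (uw , kept e , kept f)
    far (step _ (step _ (step _ _)) , s≤s (s≤s ()))

  -- Graphs with at least four vertices

  -- Otherwise labelling each vertex as `u`, `v` or `w` would inject at least four vertices into
  -- three colours.
  fourth : 4 ≤ n → ∀ u v w → ∃[ z ] z ≢ u × z ≢ v × z ≢ w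
  fourth 4≤n u v w
    with any? (λ z → ¬? (z ≟ u) ×-dec ¬? (z ≟ v) ×-dec ¬? (z ≟ w))
  ... | yes found = found
  ... | no none =
    let (i , j , i<j , same) = pigeonhole {m = 3} 4≤n (λ z → proj₁ (colour z)) in
    contradiction (unique (proj₁ (colour j)) (subst (Which i) same (proj₂ (colour i)))
                          (proj₂ (colour j)))
                  (<⇒≢ i<j)
    where
    Which : Fin n → Fin 3 → Set
    Which z 0F = z ≡ u
    Which z 1F = z ≡ v
    Which z 2F = z ≡ w
    unique : ∀ {z z'} c → Which z c → Which z' c → z ≡ z'
    unique 0F refl refl = refl
    unique 1F refl refl = refl
    unique 2F refl refl = refl
    colour : ∀ z → Σ (Fin 3) (Which z)
    colour z with z ≟ u | z ≟ v | z ≟ w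
    ... | yes p | _     | _     = 0F , p
    ... | no _  | yes p | _     = 1F , p
    ... | no _  | no _  | yes p = 2F , p
    ... | no p  | no q  | no r  = contradiction (z , p , q , r) none

  lookup-≢ : ∀ {xs : List (Fin n)} → Unique xs → ∀ {i j} → i Fin.< j →
             List.lookup xs i ≢ List.lookup xs j
  lookup-≢ (x∉xs ∷ _) {zero}  {suc j} _         = All.lookup x∉xs (∈-lookup j)
  lookup-≢ (_ ∷ uniq) {suc i} {suc j} (s≤s i<j) = lookup-≢ uniq i<j

  Unique⇒length≤ : ∀ {xs : List (Fin n)} → Unique xs → List.length xs ≤ n
  Unique⇒length≤ {xs} uniq = ≮⇒≥ λ n<length →
    let (i , j , i<j , same) = pigeonhole n<length (List.lookup xs) in lookup-≢ uniq i<j same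

  length-vertices : ∀ {G : Graph n} {u v} (p : Walk G u v) →
                    List.length (vertices p) ≡ suc (edgeCount p)
  length-vertices stop       = refl
  length-vertices (step _ p) = cong suc (length-vertices p)

  -- A path joining the far pair has at least three edges, and its vertices are distinct.
  Diameter₃⇒4≤ : ∀ {G} → Diameter₃ G → 4 ≤ n
  Diameter₃⇒4≤ (near₃ , u , v , far) with Walk→Path (proj₁ (near₃ u v))
  ... | (p , uniq) , _ = ≤-trans (s≤s (≰⇒> λ p≤2 → far (p , p≤2)))
    (≤-trans (≤-reflexive (sym (length-vertices p))) (Unique⇒length≤ uniq))

  -- Edges away from `u` are common to `G`, `H` and `K`; at `u`, the graph `K` has `uv` in place of
  -- `uw`. Hence walks of `K` that are too short produce triangles or four-cycles in `H`.
  second-removal : ∀ {G H K u v w} → 4 ≤ n → H ≅ G - u — v → K ≅ G - u — w → Triangle G u v w →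
    (∀ x y → Short G 2 x y) → (∀ x y → Short H 2 x y) → ¬ Cyclic H → Diameter₃ K
  second-removal {G} {H} {K} {u} {v} {w} 4≤n H≅ K≅ (uv , uw , wv) near₂ near₂ᴴ acyclic =
    triangle-removal K≅ (uw , uv , edge-sym G wv) near₂ , farPair
    where
    module H = _≅_-_—_ H≅
    module K = _≅_-_—_ K≅
    avoids : ∀ {x y} → Edge G x y → x ≢ u → y ≢ u → Edge H x y
    avoids e x≢u y≢u = H.intact e λ { (inj₁ (p , _)) → x≢u p ; (inj₂ (_ , q)) → y≢u q }
    w≢u : w ≢ u
    w≢u = edge-≢ G uw ∘ sym
    v≢u : v ≢ u
    v≢u = edge-≢ G uv ∘ sym
    v≢w : v ≢ w
    v≢w = edge-≢ G wv ∘ sym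
    from-u : ∀ {y} → Edge G u y → y ≢ v → Edge H u y
    from-u e y≢v = H.intact e λ { (inj₁ (_ , q)) → y≢v q ; (inj₂ (u≡v , _)) → v≢u (sym u≡v) }
    uwᴴ : Edge H u w
    uwᴴ = from-u uw (v≢w ∘ sym)
    farPair : ∃₂ λ x y → ¬ Short K 2 x y
    farPair with any? (λ y → edge? G u y ×-dec ¬? (y ≟ v) ×-dec ¬? (y ≟ w))
    -- `u` has a further neighbour `y`. In `K` a walk of length at most 2 from `w` to `y` cannot
    -- pass through `u`, as `uw` is missing, so with w-u-y it closes a cycle in `H`.
    ... | yes (y , uy , y≢v , y≢w) = w , y , far
      where
      y≢u : y ≢ u
      y≢u = edge-≢ G uy ∘ sym
      uyᴴ : Edge H u y
      uyᴴ = from-u uy y≢v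
      far : ¬ Short K 2 w y
      far (stop , _)        = y≢w refl
      far (step e stop , _) =
        acyclic (inj₁ (u , y , w , uyᴴ , uwᴴ , avoids (K.kept e) w≢u y≢u))
      far (step {v = z} e (step f stop) , _) = acyclic (inj₂ (w , z , y , u ,
        (avoids (K.kept e) w≢u z≢u , avoids (K.kept f) z≢u y≢u , edge-sym H uwᴴ , uyᴴ) ,
        y≢w ∘ sym , z≢u))
        where
        z≢u : z ≢ u
        z≢u refl = K.removed e (inj₂ (refl , refl))
      far (step _ (step _ (step _ _)) , s≤s (s≤s ()))
    -- All neighbours of `u` are `v` or `w`. In `H` the way from `u` to a fourth vertex `z` starts
    -- with `w`, so `wz` is an edge. In `K` it would start with `v`, and an edge `vz` would give the
    -- triangle v, z, w in `H`.
    ... | no none = let (z , z≢u , z≢v , z≢w) = fourth 4≤n u v w in u , z , far z≢u z≢v z≢w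
      where
      neighbour : ∀ {y} → Edge G u y → y ≡ v ⊎ y ≡ w
      neighbour {y} e with y ≟ v | y ≟ w
      ... | yes p | _     = inj₁ p
      ... | no _  | yes q = inj₂ q
      ... | no p  | no q  = contradiction (y , e , p , q) none
      wz : ∀ {z} → z ≢ u → z ≢ v → z ≢ w → Edge H w z
      wz {z} z≢u z≢v z≢w with near₂ᴴ u z
      ... | stop , _ = contradiction refl z≢u
      ... | step e stop , _ = contradiction (neighbour (H.kept e)) [ z≢v , z≢w ]′
      ... | step e (step f stop) , _ with neighbour (H.kept e)
      ...   | inj₁ refl = contradiction (inj₁ (refl , refl)) (H.removed e)
      ...   | inj₂ refl = f
      wz _ _ _ | step _ (step _ (step _ _)) , s≤s (s≤s ())
      far : ∀ {z} → z ≢ u → z ≢ v → z ≢ w → ¬ Short K 2 u z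
      far z≢u z≢v z≢w (stop , _) = z≢u refl
      far z≢u z≢v z≢w (step e stop , _) = [ z≢v , z≢w ]′ (neighbour (K.kept e))
      far {z} z≢u z≢v z≢w (step e (step f stop) , _) with neighbour (K.kept e)
      ... | inj₁ refl = acyclic (inj₁ (v , z , w , avoids (K.kept f) v≢u z≢u ,
              avoids (edge-sym G wv) v≢u w≢u , wz z≢u z≢v z≢w))
      ... | inj₂ refl = K.removed e (inj₁ (refl , refl))
      far _ _ _ (step _ (step _ (step _ _)) , s≤s (s≤s ()))

  -- Sufficiency and necessity of the criterion

  _⊑_ : Graph n → Graph n → Set
  H ⊑ G = ∀ {u v} → Edge H u v → Edge G u v

  far? : ∀ G → Dec (∃₂ λ u v → ¬ Short G 2 u v)
  far? G = any? λ u → any? λ v → ¬? (short? G 2 u v)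

  near-all : ∀ G → ¬ (∃₂ λ u v → ¬ Short G 2 u v) → ∀ u v → Short G 2 u v
  near-all G none u v = decidable-stable (short? G 2 u v) λ ¬s → none (u , v , ¬s)

  -- Edges in triangles are removed one after the other; pairs that are not in
  -- the list lie in no triangle, and this is inherited by subgraphs.
  thin-out : ∀ {G} → 4 ≤ n → (∀ u v → Short G 2 u v) → Cyclic G → (pairs : List (Fin n × Fin n)) →
    (∀ u v → (u , v) ∈ pairs ⊎ (∀ w → ¬ Triangle G u v w)) → ∃[ H ] H ⊑ G × Diameter₃ H
  -- With no pair left, no edge lies in a triangle, so the cycle at hand has length four.
  thin-out 4≤n near₂ (inj₁ (u , v , w , t)) [] cover with cover u v
  ... | inj₂ none = contradiction t (none w)
  thin-out {G} 4≤n near₂ (inj₂ (u , w , v , w' , c)) [] cover with removeEdge G u w | cover u w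
  ... | H , H≅ | inj₂ none = H , _≅_-_—_.kept H≅ , fourCycle-removal H≅ c none near₂
  thin-out {G} 4≤n near₂ cyc ((u , v) ∷ pairs) cover
    with any? (λ w → edge? G u v ×-dec edge? G u w ×-dec edge? G w v)
  ... | no none = thin-out 4≤n near₂ cyc pairs cover'
    where
    cover' : ∀ x y → (x , y) ∈ pairs ⊎ (∀ w → ¬ Triangle G x y w)
    cover' x y with cover x y
    ... | inj₁ (here refl) = inj₂ (λ w t → none (w , t))
    ... | inj₁ (there p)   = inj₁ p
    ... | inj₂ q           = inj₂ q
  ... | yes (w , t) with removeEdge G u v
  ...   | H , H≅ with far? H | cyclic? H
  ...     | yes far | _ = H , _≅_-_—_.kept H≅ , triangle-removal H≅ t near₂ , far
  ...     | no ¬far | no acyclic with removeEdge G u w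
  ...       | K , K≅ = K , _≅_-_—_.kept K≅ ,
                       second-removal 4≤n H≅ K≅ t near₂ (near-all H ¬far) acyclic
  thin-out {G} 4≤n near₂ cyc ((u , v) ∷ pairs) cover
      | yes (w , t) | H , H≅ | no ¬far | yes cycᴴ =
    map₂ (λ (K⊑H , d) → kept ∘ K⊑H , d) (thin-out 4≤n (near-all H ¬far) cycᴴ pairs cover')
    where
    open _≅_-_—_ H≅
    cover' : ∀ x y → (x , y) ∈ pairs ⊎ (∀ w → ¬ Triangle H x y w)
    cover' x y with cover x y
    ... | inj₁ (here refl) = inj₂ (λ w (e , _) → removed e (inj₁ (refl , refl)))
    ... | inj₁ (there p)   = inj₁ p
    ... | inj₂ q           = inj₂ (λ w (e , f , g) → q w (kept e , kept f , kept g))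

  Criterion : Graph n → Set
  Criterion G = 4 ≤ n × (∀ u v → Short G 3 u v) × ((∃₂ λ u v → ¬ Short G 2 u v) ⊎ Cyclic G)

  sufficient : ∀ G → Criterion G → ∃[ H ] H ⊑ G × Diameter₃ H
  sufficient G (4≤n , near₃ , obstruction) with far? G
  ... | yes far = G , (λ e → e) , near₃ , far
  ... | no ¬far with obstruction
  ...   | inj₁ far = contradiction far ¬far
  ...   | inj₂ cyc = thin-out 4≤n (near-all G ¬far) cyc (cartesianProduct (allFin n) (allFin n))
    (λ u v → inj₁ (∈-cartesianProduct⁺ (∈-allFin u) (∈-allFin v)))

  -- If `G` has no triangle and no four-cycle, then no edge of `G` is missing from `H`: a walk of
  -- length at most 3 replacing it would close such a cycle. So the far pair of `H` is also far in
  -- `G`.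
  necessary : ∀ G H → H ⊑ G → Diameter₃ H → Criterion G
  necessary G H H⊑G d@(near₃ , u , v , far) = Diameter₃⇒4≤ d , (λ x y → Short-⊆ H⊑G (near₃ x y)) , obstruction
    where
    obstruction : (∃₂ λ x y → ¬ Short G 2 x y) ⊎ Cyclic G
    obstruction with cyclic? G
    ... | yes cyc = inj₂ cyc
    ... | no acyclic = inj₁ (u , v , far ∘ Short-⊆ (λ {x} {y} → G⊑H {x} {y}))
      where
      closes : ∀ {x y} → Edge G x y → ¬ Edge H x y → ¬ Short H 3 x y
      closes xy ¬xy (stop , _)        = edge-≢ G xy refl
      closes xy ¬xy (step e stop , _) = ¬xy e
      closes xy ¬xy (step e (step f stop) , _) = acyclic (inj₁ (_ , _ , _ , xy , H⊑G e , H⊑G f))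
      -- Coinciding ends of a diagonal would make `xy` itself an edge of `H`.
      closes {x} {y} xy ¬xy (step {v = a} e (step {v = b} f (step g stop)) , _) =
        acyclic (inj₂ (x , a , b , y , (H⊑G e , H⊑G f , xy , edge-sym G (H⊑G g)) ,
          (λ { refl → ¬xy g }) , λ { refl → ¬xy e }))
      closes xy ¬xy (step _ (step _ (step _ (step _ _))) , s≤s (s≤s (s≤s ())))
      G⊑H : G ⊑ H
      G⊑H {x} {y} e = decidable-stable (edge? H x y) λ ¬e → closes e ¬e (near₃ x y)

-- What the procedure computes

count-cong : ∀ {n} {p q : Fin n → Bool} → (∀ i → p i ≡ q i) → count p ≡ count q
count-cong {zero}  eq = refl
count-cong {suc n} eq rewrite eq zero = cong (_ +_) (count-cong (eq ∘ suc))

count-∧-false : ∀ {n} (p : Fin n → Bool) → count (λ j → p j ∧ false) ≡ 0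
count-∧-false {zero}  p = refl
count-∧-false {suc n} p with p zero
... | true  = count-∧-false (p ∘ suc)
... | false = count-∧-false (p ∘ suc)

count-unit : ∀ {n} (p : Fin n → Bool) i →
             count (λ j → p j ∧ unit (toℕ i) j) ≡ (if p i then 1 else 0)
count-unit {suc n} p zero with p zero
... | true  = cong suc (count-∧-false (p ∘ suc))
... | false = count-∧-false (p ∘ suc)
count-unit {suc n} p (suc i) with p zero
... | true  = count-unit (p ∘ suc) i
... | false = count-unit (p ∘ suc) i

count-positive : ∀ {n} (p : Fin n → Bool) i → p i ≡ true → 1 ≤ count p
count-positive p zero    pi rewrite pi = s≤s z≤n
count-positive p (suc i) pi = ≤-trans (count-positive (p ∘ suc) i pi) (m≤n+m _ _)

count-two : ∀ {n} (p : Fin n → Bool) i j → i ≢ j → p i ≡ true → p j ≡ true → 2 ≤ count p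
count-two p zero    zero    i≢j pi pj = contradiction refl i≢j
count-two p zero    (suc j) i≢j pi pj rewrite pi = s≤s (count-positive (p ∘ suc) j pj)
count-two p (suc i) zero    i≢j pi pj rewrite pj = s≤s (count-positive (p ∘ suc) i pi)
count-two p (suc i) (suc j) i≢j pi pj =
  ≤-trans (count-two (p ∘ suc) i j (i≢j ∘ cong suc) pi pj) (m≤n+m _ _)

count-witness : ∀ {n} (p : Fin n → Bool) → 1 ≤ count p → ∃[ i ] p i ≡ true
count-witness {suc n} p 1≤c with p zero in eq
... | true  = zero , eq
... | false = let (i , pi) = count-witness (p ∘ suc) 1≤c in suc i , pi

count-witnesses : ∀ {n} (p : Fin n → Bool) → 2 ≤ count p →
                  ∃₂ λ i j → i ≢ j × p i ≡ true × p j ≡ true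
count-witnesses {suc n} p 2≤c with p zero in eq
... | true  = let (i , pi) = count-witness (p ∘ suc) (≤-pred 2≤c) in
              zero , suc i , (λ ()) , eq , pi
... | false = let (i , j , i≢j , pi , pj) = count-witnesses (p ∘ suc) 2≤c in
              suc i , suc j , i≢j ∘ suc-injective , pi , pj

any-witness : ∀ {n} (p : Fin n → Bool) → any p ≡ true → ∃[ i ] p i ≡ true
any-witness {suc n} p eq with p zero in p0
... | true  = zero , p0
... | false = let (i , pi) = any-witness (p ∘ suc) eq in suc i , pi

any-intro : ∀ {n} (p : Fin n → Bool) i → p i ≡ true → any p ≡ true
any-intro p zero    pi rewrite pi = refl
any-intro p (suc i) pi with p zero
... | true  = refl
... | false = any-intro (p ∘ suc) i pi

anyFrom-witness : ∀ k j (p : ℕ → Bool) → anyFrom k j p ≡ true → ∃[ i ] i < k + j × p i ≡ true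
anyFrom-witness k (suc j) p eq with p k in pk
... | true  = k , m<m+n k (s≤s z≤n) , pk
... | false = let (i , i< , pi) = anyFrom-witness (suc k) j p eq in
              i , subst (i <_) (sym (+-suc k j)) i< , pi

anyFrom-intro : ∀ k j (p : ℕ → Bool) i → i < j → p (k + i) ≡ true → anyFrom k j p ≡ true
anyFrom-intro k (suc j) p zero    _ pi rewrite +-identityʳ k | pi = refl
anyFrom-intro k (suc j) p (suc i) (s≤s i<j) pi with p k
... | true  = refl
... | false = anyFrom-intro (suc k) j p i i<j (subst (λ x → p x ≡ true) (+-suc k i) pi)

anyVertex : ∀ {n} (p : ℕ → Fin n → Bool) →
  anyFrom 0 n (any ∘ p) ≡ true ⇔ (∃₂ λ (u i : Fin n) → p (toℕ u) i ≡ true)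
anyVertex {n} p = mk⇔ to from
  where
  to : anyFrom 0 n (any ∘ p) ≡ true → ∃₂ λ (u i : Fin n) → p (toℕ u) i ≡ true
  to eq with anyFrom-witness 0 n (any ∘ p) eq
  ... | k , k<n , anyₖ =
    let (i , pi) = any-witness (p k) anyₖ in
    fromℕ< k<n , i , subst (λ k → p k i ≡ true) (sym (toℕ-fromℕ< k<n)) pi
  from : (∃₂ λ (u i : Fin n) → p (toℕ u) i ≡ true) → anyFrom 0 n (any ∘ p) ≡ true
  from (u , i , pi) = anyFrom-intro 0 n (any ∘ p) (toℕ u) (toℕ<n u) (any-intro (p (toℕ u)) i pi)

≢⇒unit : ∀ {n} {u i : Fin n} → i ≢ u → unit (toℕ u) i ≡ false
≢⇒unit {u = u} {i} i≢u with toℕ i ≡ᵇ toℕ u in eq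
... | false = refl
... | true  = contradiction (toℕ-injective (≡ᵇ⇒≡ _ _ (Equivalence.from T-≡ eq))) i≢u

unit⇒≢ : ∀ {n} {u i : Fin n} → not (unit (toℕ u) i) ≡ true → i ≢ u
unit⇒≢ {u = u} eq refl rewrite ≡ᵇ-refl (toℕ u) with eq
... | ()

∧-intro : ∀ {a b} → a ≡ true → b ≡ true → a ∧ b ≡ true
∧-intro refl refl = refl

∧-elim : ∀ {a b} → a ∧ b ≡ true → a ≡ true × b ≡ true
∧-elim {true} refl = refl , refl

isOne-true : ∀ {m} → isOne m ≡ true → m ≡ 1
isOne-true {1} _ = refl

-- Counting short walks and the criterion

module _ {n} (G : Graph n) where

  commonNeighbour : Fin n → Fin n → Fin n → Bool
  commonNeighbour u v w = adj G u w ∧ adj G w v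

  shortWalks : Fin n → Fin n → ℕ
  shortWalks u v = (if adj G u v then 1 else 0) + count (commonNeighbour u v)

  walks₁≡ : ∀ u i → walks₁ (adj G) (toℕ u) i ≡ (if adj G i u then 1 else 0)
  walks₁≡ u i = count-unit (adj G i) u

  walks₂≡ : ∀ u i → walks₂ (adj G) (toℕ u) i ≡ shortWalks i u
  walks₂≡ u i = cong₂ _+_ (walks₁≡ u i) (count-cong λ j → cong (adj G i j ∧_)
    (trans (cong (not ∘ isZero) (walks₁≡ u j)) (positive (adj G j u))))
    where
    positive : ∀ b → not (isZero (if b then 1 else 0)) ≡ b
    positive true  = refl
    positive false = refl

  walk-counted : ∀ {u v} → u ≢ v → Short G 2 u v → 1 ≤ shortWalks u v
  walk-counted u≢v (stop , _) = contradiction refl u≢v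
  walk-counted u≢v (step e stop , _) rewrite e = s≤s z≤n
  walk-counted {u} {v} u≢v (step {v = w} e (step f stop) , _) =
    ≤-trans (count-positive (commonNeighbour u v) w (∧-intro e f)) (m≤n+m _ _)
  walk-counted u≢v (step _ (step _ (step _ _)) , s≤s (s≤s ()))

  counted-walk : ∀ {u v} → 1 ≤ shortWalks u v → Short G 2 u v
  counted-walk {u} {v} pos with adj G u v in e
  ... | true  = e ▸ done
  ... | false =
    let (w , both) = count-witness (commonNeighbour u v) pos
        (f , g) = ∧-elim both in f ▸ g ▸ done

  -- An edge and a two-edge walk with the same ends form a triangle; two such two-edge walks form a
  -- four-cycle.
  several-walks : ∀ {u v} → u ≢ v → 2 ≤ shortWalks u v → Cyclic G
  several-walks {u} {v} u≢v two with adj G u v in e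
  ... | true  =
    let (w , both) = count-witness (commonNeighbour u v) (≤-pred two)
        (f , g) = ∧-elim both in inj₁ (u , v , w , e , f , g)
  ... | false =
    let (w , w' , w≢w' , both , both') = count-witnesses (commonNeighbour u v) two
        (f , g) = ∧-elim both ; (f' , g') = ∧-elim both' in
    inj₂ (u , w , v , w' , (f , g , f' , g') , u≢v , w≢w')

  cyclic-several : Cyclic G → ∃₂ λ u v → u ≢ v × 2 ≤ shortWalks u v
  cyclic-several (inj₁ (u , v , w , e , f , g)) = u , v , edge-≢ G e , two
    where
    two : 2 ≤ shortWalks u v
    two rewrite e = s≤s (count-positive (commonNeighbour u v) w (∧-intro f g))
  cyclic-several (inj₂ (u , w , v , w' , (f , g , f' , g') , u≢v , w≢w')) = u , v , u≢v ,
    ≤-trans (count-two (commonNeighbour u v) w w' w≢w' (∧-intro f g) (∧-intro f' g')) (m≤n+m _ _)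

  foundPair : Bool
  foundPair = anyFrom 0 n (any ∘ notOne (adj G))

  farPair : Bool
  farPair = anyFrom 0 n (any ∘ tooFar (adj G))

  -- A count other than 1 is 0, which gives a far pair, or at least 2, which gives a cycle.
  foundPair-correct : foundPair ≡ true ⇔ ((∃₂ λ u v → ¬ Short G 2 u v) ⊎ Cyclic G)
  foundPair-correct = mk⇔ to from
    where
    classify : ∀ {u v} → u ≢ v → not (isOne (shortWalks u v)) ≡ true →
               (∃₂ λ u v → ¬ Short G 2 u v) ⊎ Cyclic G
    classify {u} {v} u≢v eq with shortWalks u v in c
    ... | 0 = inj₁ (u , v , λ w → contradiction (subst (1 ≤_) c (walk-counted u≢v w)) (λ ()))
    ... | suc (suc _) = inj₂ (several-walks u≢v (subst (2 ≤_) (sym c) (s≤s (s≤s z≤n))))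
    to : foundPair ≡ true → (∃₂ λ u v → ¬ Short G 2 u v) ⊎ Cyclic G
    to eq with Equivalence.to (anyVertex (notOne (adj G))) eq
    ... | u , i , p = let (q , r) = ∧-elim p in
      classify (unit⇒≢ q) (subst (λ m → not (isOne m) ≡ true) (walks₂≡ u i) r)
    found : ∀ {u i} → i ≢ u → isOne (shortWalks i u) ≡ false → foundPair ≡ true
    found {u} {i} i≢u ¬one = Equivalence.from (anyVertex (notOne (adj G))) (u , i ,
      ∧-intro (cong not (≢⇒unit i≢u)) (cong not (trans (cong isOne (walks₂≡ u i)) ¬one)))
    from : (∃₂ λ u v → ¬ Short G 2 u v) ⊎ Cyclic G → foundPair ≡ true
    from (inj₁ (u , v , ¬short)) = found (λ { refl → ¬short done }) ¬one
      where
      ¬one : isOne (shortWalks u v) ≡ false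
      ¬one with isOne (shortWalks u v) in eq
      ... | false = refl
      ... | true  = contradiction (counted-walk (≤-reflexive (sym (isOne-true eq)))) ¬short
    from (inj₂ cyc) = let (u , v , u≢v , two) = cyclic-several cyc in found u≢v (¬one two)
      where
      ¬one : ∀ {m} → 2 ≤ m → isOne m ≡ false
      ¬one (s≤s (s≤s _)) = refl

  farPair-correct : farPair ≡ true ⇔ (∃₂ λ u v → ¬ Short G 3 u v)
  farPair-correct = mk⇔ to from
    where
    positive : ∀ {m} → 1 ≤ m → isZero m ≡ false
    positive (s≤s _) = refl
    isZero-false : ∀ {m} → isZero m ≡ false → 1 ≤ m
    isZero-false {suc _} _ = s≤s z≤n
    next-step : Fin n → Fin n → Fin n → Bool
    next-step u i j = adj G i j ∧ not (isZero (walks₂ (adj G) (toℕ u) j))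
    counted : ∀ {u i} → i ≢ u → Short G 3 i u → 1 ≤ walks₃ (adj G) (toℕ u) i
    counted i≢u (stop , _) = contradiction refl i≢u
    counted {u} {i} i≢u (step {v = j} e p , s≤s p≤2) with j ≟ u
    -- If the first step already reaches `u`, the rest may be empty and hence uncounted; the edge
    -- itself then contributes to the summand `walks₂`.
    ... | yes refl = ≤-trans (≤-trans (walk-counted i≢u (e ▸ done)) (≤-reflexive (sym (walks₂≡ u i))))
                             (m≤m+n _ _)
    ... | no j≢u = ≤-trans (count-positive (next-step u i) j (∧-intro e (cong not (positive
                     (≤-trans (walk-counted j≢u (p , p≤2)) (≤-reflexive (sym (walks₂≡ u j))))))))
                     (m≤n+m _ _)
    walk : ∀ {u i} → 1 ≤ walks₃ (adj G) (toℕ u) i → Short G 3 i u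
    walk {u} {i} pos with walks₂ (adj G) (toℕ u) i in eq
    ... | suc m = Short-mono (s≤s (s≤s z≤n)) (counted-walk
                    (≤-trans (s≤s z≤n) (≤-reflexive (trans (sym eq) (walks₂≡ u i)))))
    ... | zero with count-witness (next-step u i) pos
    ...   | j , both with ∧-elim both
    ...     | e , p = e ▸ counted-walk (≤-trans (isZero-false (not-true p)) (≤-reflexive (walks₂≡ u j)))
      where
      not-true : ∀ {b} → not b ≡ true → b ≡ false
      not-true {false} _ = refl
    to : farPair ≡ true → ∃₂ λ u v → ¬ Short G 3 u v
    to eq with Equivalence.to (anyVertex (tooFar (adj G))) eq
    ... | u , i , p = let (q , r) = ∧-elim p in
      i , u , λ short → contradiction (trans (sym r) (positive (counted (unit⇒≢ q) short))) (λ ())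
    from : (∃₂ λ u v → ¬ Short G 3 u v) → farPair ≡ true
    from (i , u , ¬short) = Equivalence.from (anyVertex (tooFar (adj G))) (u , i ,
      ∧-intro (cong not (≢⇒unit i≢u)) zero₃)
      where
      i≢u : i ≢ u
      i≢u refl = ¬short done
      zero₃ : isZero (walks₃ (adj G) (toℕ u) i) ≡ true
      zero₃ with isZero (walks₃ (adj G) (toℕ u) i) in eq
      ... | true  = refl
      ... | false = contradiction (walk (isZero-false eq)) ¬short

  -- This has the shape of `verdictOf` applied to the final flags of the machine.
  decide : Bool
  decide = foundPair ∧ not ((n <ᵇ 4) ∨ farPair)

  decide-correct : decide ≡ true ⇔ Criterion G
  decide-correct = mk⇔ to from
    where
    split : ∀ {f few isFar} → f ∧ not (few ∨ isFar) ≡ true →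
            f ≡ true × few ≡ false × isFar ≡ false
    split {true} {false} {false} _ = refl , refl , refl
    to : decide ≡ true → Criterion G
    to eq = let (found , many , noFar) = split eq in
      ≮⇒≥ (not-¬ many ∘ Equivalence.to T-≡ ∘ <⇒<ᵇ) ,
      (λ u v → decidable-stable (short? G 3 u v) λ ¬short →
        not-¬ noFar (Equivalence.from farPair-correct (u , v , ¬short))) ,
      Equivalence.to foundPair-correct found
    from : Criterion G → decide ≡ true
    from (4≤n , near₃ , obstruction) =
      ∧-intro (Equivalence.from foundPair-correct obstruction)
        (cong₂ (λ few isFar → not (few ∨ isFar))
          (¬-not (λ few → ≤⇒≯ 4≤n (<ᵇ⇒< n 4 (Equivalence.from T-≡ few))))
          (¬-not (λ isFar → let (u , v , ¬short) = Equivalence.to farPair-correct isFar in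
                            ¬short (near₃ u v))))

-- Input, running time and correctness

inputTape≡toTape : ∀ {a} (w : List Bool) → inputTape {a} w ≡ toTape [] (List.map bit w)
inputTape≡toTape []      = refl
inputTape≡toTape (_ ∷ _) = refl

map-encodeGraph : ∀ {n} (G : Graph n) →
  List.map bit (encodeGraph G) ≡ replicate n (bit true) ++ bit false ∷ rows (adj G)
map-encodeGraph {n} G = begin
  List.map bit (replicate n true ++ false ∷ concat matrix)
    ≡⟨ map-++ bit (replicate n true) _ ⟩
  List.map bit (replicate n true) ++ bit false ∷ List.map bit (concat matrix)
    ≡⟨ cong₂ (λ xs ys → xs ++ bit false ∷ ys) (map-replicate bit n true) (begin
      List.map bit (concat matrix)            ≡⟨ concat-map matrix ⟨
      concat (List.map (List.map bit) matrix) ≡⟨ cong concat (map-tabulate (tabulate ∘ adj G) (List.map bit)) ⟩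
      concat (tabulate (λ u → List.map bit (tabulate (adj G u))))
        ≡⟨ cong concat (tabulate-cong (λ u → map-tabulate (adj G u) bit)) ⟩
      rows (adj G) ∎) ⟩
  replicate n (bit true) ++ bit false ∷ rows (adj G) ∎
  where
  open ≡-Reasoning
  matrix = tabulate (λ u → tabulate (adj G u))

length-encodeGraph : ∀ {n} (G : Graph n) → length (encodeGraph G) ≡ n + suc (n * n)
length-encodeGraph {n} G = begin
  length (encodeGraph G)                                ≡⟨ length-map bit (encodeGraph G) ⟨
  length (List.map (bit {8}) (encodeGraph G))           ≡⟨ cong length (map-encodeGraph G) ⟩
  length (replicate n (bit true) ++ bit false ∷ rows (adj G)) ≡⟨ length-++ (replicate n (bit true)) ⟩
  length (replicate n (bit true)) + suc (length (rows (adj G)))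
    ≡⟨ cong₂ (λ x y → x + suc y) (length-replicate n) (length-rows (adj G)) ⟩
  n + suc (n * n) ∎
  where open ≡-Reasoning

eda₃ : Prog
eda₃ = prepare ⨾ examineAll

verdictOf : Flags → Bool
verdictOf (found , bad , _) = found ∧ not bad

accepting : Heads {8} {4} → Bool
accepting h = verdictOf (readFlags (Vec.lookup h 4F))

runningTime : ℕ → ℕ
runningTime n = 4 * (n * n) + 8 * n + 16 +
                (8 * n + 10 + (n * (18 * (n * n) + 64 * n + 72) + 1)) + 1

eda₃-answers : ∀ {n} (G : Graph n) →
  AnswersWithin (compile eda₃ accepting) (runningTime n) (encodeGraph G) (decide G)
eda₃-answers {n} G =
  let (ts , d , eq) = examineAll-executes (adj G) {s = const false} {t = const 0} {b = n <ᵇ 4} in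
  subst (AnswersWithin (compile eda₃ accepting) (runningTime n) (encodeGraph G))
    (cong verdictOf eq)
    (compile-answers eda₃ accepting
      (from-≡ (cong (_∷ _) (trans (inputTape≡toTape (encodeGraph G))
                                  (cong (toTape []) (map-encodeGraph G))))
              (prepare-executes (adj G) then d)))

-- ℓ² = (n² + n + 1)² dominates the cubic running time.
runningTime-bound : ∀ n → runningTime n ≤ 44 * (n + suc (n * n)) ^ 2 + 44
-- The factor 44 makes the linear terms on both sides agree, at 88n. The difference then has
-- nonnegative coefficients and is added as an explicit slack.
runningTime-bound n = subst (runningTime n ≤_) (slack n) (m≤m+n (runningTime n) _)
  where
  slack : ∀ n → 4 * (n * n) + 8 * n + 16 + (8 * n + 10 + (n * (18 * (n * n) + 64 * n + 72) + 1)) + 1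
            + (44 * (n * n * (n * n)) + 70 * (n * (n * n)) + 64 * (n * n) + 60)
          ≡ 44 * ((n + suc (n * n)) * ((n + suc (n * n)) * 1)) + 44
  slack = solve-∀

diameter₃-criterion : ∀ {n} (G : Graph n) → Criterion G ⇔
  Σ (EdgeSubset G) λ F → Connected (G ─ F) × Diameter (G ─ F) 3
diameter₃-criterion {n} G = mk⇔ to from
  where
  to : Criterion G → Σ (EdgeSubset G) λ F → Connected (G ─ F) × Diameter (G ─ F) 3
  to c with sufficient G c
  ... | H , H⊑G , d =
    -- `F` consists of the edges of `G` outside `H`. The graph `G ─ F` has the edges of `H` but is
    -- another record, so the diameter is transferred along the edges.
    F , Diameter₃-sound (Diameter₃-cong (λ {u} {v} → H⊑G─F {u} {v}) (λ {u} {v} → G─F⊑H {u} {v}) d)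
    where
    F : EdgeSubset G
    F .mem u v     = adj G u v ∧ not (adj H u v)
    F .mem-sym u v = cong₂ (λ a b → a ∧ not b) (adj-sym G u v) (adj-sym H u v)
    F .subset u v  = proj₁ ∘ ∧-elim
    H⊑G─F : ∀ {u v} → Edge H u v → Edge (G ─ F) u v
    H⊑G─F {u} {v} e rewrite H⊑G e | e = refl
    G─F⊑H : ∀ {u v} → Edge (G ─ F) u v → Edge H u v
    G─F⊑H {u} {v} e with adj G u v | adj H u v
    ... | true | true = refl
  from : (Σ (EdgeSubset G) λ F → Connected (G ─ F) × Diameter (G ─ F) 3) → Criterion G
  from (F , _ , d) = necessary G (G ─ F) (proj₁ ∘ ∧-elim) (Diameter₃-complete d)

corollary4p4 : PolynomialTimeSolvable (EDA 3)
corollary4p4 = compile eda₃ accepting , 44 , 2 , λ I →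
  let open ConnectedGraph I
      module C = Equivalence (decide-correct graph)
      module D = Equivalence (diameter₃-criterion graph)
      (t , t≤ , answer) = eda₃-answers graph
  in decide graph ,
     (t , ≤-trans t≤ (≤-trans (runningTime-bound order)
            (≤-reflexive (cong (λ ℓ → 44 * ℓ ^ 2 + 44) (sym (length-encodeGraph graph))))) , answer) ,
     mk⇔ (D.to ∘ C.to) (C.from ∘ D.from)
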